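{- In the quaternion algebra $\left(\frac{ -1,-1}{\mathbb Q}\right)$ with basis $1,\mathbf i,\mathbf j,\mathbf k$ ($\mathbf i^2=\mathbf j^2=-1$, $\mathbf k=\mathbf i\mathbf j=-\mathbf j\mathbf i$), let $\mathcal G=\mathbb Z\oplus\mathbb Z2\mathbf i\oplus\mathbb Z2\mathbf j\oplus\mathbb Z(\mathbf i+\mathbf k)$. For a positive integer $n$ with $2$-adic valuation $e$, $$r_{\mathcal G}(n)=2\sum_{d\mid n,\ d\text{ odd}}d\cdot\begin{cases}1,&e=0,\\2,&e=1,\\4,&e=2,\\12,&e\ge3.\end{cases}$$
   Context: $r_{\mathcal G}(n)=\#\{\mathbf q\in\mathcal G:\operatorname{nrd}(\mathbf q)=n\}$ where $\operatorname{nrd}(t+x\mathbf i+y\mathbf j+z\mathbf k)=t^2+x^2+y^2+z^2$; the sum is over positive odd divisors $d$ of $n$. -}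

module Defs where

open import Data.Nat as ℕ using (ℕ; _%_)
open import Data.Nat.ListAction using (sum)
open import Data.Nat.Divisibility using (_∣_; _∣?_)
open import Data.Integer as ℤ using (ℤ; +_)
open import Data.List using (List; filter; upTo; map)
open import Data.Product using (∃; _×_; _,_)
open import Relation.Binary.PropositionalEquality using (_≡_)
open import Relation.Nullary.Decidable using (_×-dec_)

-- Elements of the quaternion algebra (-1,-1 / ℚ) with integral coordinates
-- t + x i + y j + z k  (all of 𝒢 lies in this set).
record Quat : Set where
  constructor quat
  field
    t x y z : ℤ

nrd : Quat → ℤ
nrd (quat t x y z) = t ℤ.* t ℤ.+ x ℤ.* x ℤ.+ y ℤ.* y ℤ.+ z ℤ.* z

-- the element  a·1 + b·(2i) + c·(2j) + d·(i+k)  of 𝒢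
ofBasis : ℤ → ℤ → ℤ → ℤ → Quat
ofBasis a b c d = quat a (+ 2 ℤ.* b ℤ.+ d) (+ 2 ℤ.* c) d

_∈𝒢 : Quat → Set
q ∈𝒢 = ∃ λ a → ∃ λ b → ∃ λ c → ∃ λ d → q ≡ ofBasis a b c d

σodd : ℕ → ℕ
σodd n = sum (filter (λ d → (d ∣? n) ×-dec (d % 2 ℕ.≟ 1)) (map ℕ.suc (upTo n)))

factor : ℕ → ℕ
factor 0 = 1
factor 1 = 2
factor 2 = 4
factor _ = 12

{-# OPTIONS --safe #-}

-- Write p(i) = i(i+1) and τ(m) = Σ_{y z = m} y over y, z > 0. For odd m, the Zagier-type
-- involution (x, y, z) ↦ (-x-2y, y, z-x-y) on {x² + 4yz = 4m+1, y > 0, z > x+y}, together with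
-- (x, y, z) ↦ (-x, z, y) onto the complementary region, gives Σ y (yz - x²) = 0 over all
-- solutions with y, z > 0, that is Σ_i (m-1-5p(i)) τ(m-p(i)) = 0. The number O(m) of
-- representations of 4m by four odd squares obeys the same recurrence: by symmetry of the five
-- variables, Σ (4m+1-5x²) = 0 over the representations 4m+1 = x² + (four odd squares). Hence
-- O(m) = 16 τ(m). Multiplication by 1 + 𝐢 relates the representations of k and of 2k by four
-- squares, with congruence conditions mod 2 on the coordinates, and reduces r_𝒢(2^e m) to O(m).
module Submission where

open import Defs
open import Data.Empty using (⊥; ⊥-elim)
open import Data.Integer as ℤ
  using (ℤ; +_; -[1+_]; 0ℤ; 1ℤ; -1ℤ; _+_; _*_; -_; _-_; ∣_∣; _<_; _≤_; +<+; +≤+; -<+)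
open import Data.Integer.Divisibility.Signed
  using (_∣_; divides; quotient; _∣?_; ∣⇒∣ᵤ;
         ∣m⇒∣m*n; ∣n⇒∣m*n; ∣m∣n⇒∣m+n; ∣m∣n⇒∣m-n; ∣m⇒∣-m; ∣m+n∣m⇒∣n; ∣m+n∣n⇒∣m)
import Data.Integer.Properties as ℤ
open import Data.Integer.Tactic.RingSolver using (solve-∀)
open import Data.List using (List; []; _∷_; map; filter; foldr; length; _++_; concat; upTo)
open import Data.List.Membership.Propositional using (_∈_)
open import Data.List.Membership.Propositional.Properties
  using (∈-map⁺; ∈-map⁻; ∈-filter⁺; ∈-filter⁻; ∈-++⁺ˡ; ∈-++⁺ʳ; ∈-++⁻;
         ∈-upTo⁺; ∈-upTo⁻; ∈-concat⁺′; ∈-concat⁻′)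
open import Data.List.Membership.Propositional.Properties.WithK using (unique∧set⇒bag)
open import Data.List.Properties using (map-∘; map-++)
open import Data.List.Relation.Binary.BagAndSetEquality using (∼bag⇒↭)
open import Data.List.Relation.Binary.Permutation.Propositional using (↭⇒↭ₛ)
open import Data.List.Relation.Binary.Permutation.Propositional.Properties using (map⁺)
open import Data.List.Relation.Binary.Permutation.Setoid.Properties using (foldr-commMonoid)
open import Data.List.Relation.Unary.All as All using ([]; _∷_)
import Data.List.Relation.Unary.All.Properties as All
open import Data.List.Relation.Unary.AllPairs as AllPairs using ([]; _∷_)
import Data.List.Relation.Unary.AllPairs.Properties as AllPairs
open import Data.List.Relation.Unary.Any using (here; there)
open import Data.List.Relation.Unary.Unique.Propositional using (Unique)
import Data.List.Relation.Unary.Unique.Propositional.Properties as Unique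
open import Data.Nat as ℕ using (ℕ; zero; suc; _%_)
open import Data.Nat.Coprimality using (Coprime; coprime-divisor)
import Data.Nat.Divisibility as ℕ
open import Data.Nat.DivMod using (_/_; m≡m%n+[m/n]*n; m%n<n; m*n/n≡m; m≥n⇒m/n>0; m*[n/m]≡n)
open import Data.Nat.ListAction using (sum)
import Data.Nat.Properties as ℕ
open import Data.Product using (Σ; ∃; _×_; _,_; proj₁; proj₂)
open import Data.Sum using (_⊎_; inj₁; inj₂; [_,_]′)
open import Function using (_∘_; id)
open import Function.Bundles using (_⇔_; mk⇔)
open import Relation.Binary.Definitions using (tri<; tri≈; tri>)
open import Relation.Binary.PropositionalEquality
  using (_≡_; _≢_; refl; sym; trans; cong; cong₂; subst; subst₂; setoid; module ≡-Reasoning)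
open import Relation.Nullary using (¬_; Dec; yes; no)
open import Relation.Nullary.Decidable using (¬?; _×-dec_)
open import Relation.Nullary.Negation using (contradiction)
open import Relation.Unary using (Decidable)

-- Finite enumerations and sums over them

-- Both recurrences carry the same weight. With x = 2i + 1 one has x² = 4 p(i) + 1, so y z = m -
-- p(i) gives y z - x² = m - 1 - 5 p(i), and 4m + 1 - 5x² is four times that number. The values i =
-- 0 and i = -1 contribute 2(m - 1) times the term at m itself, so for odd m ≠ 1 that term is
-- determined by smaller odd numbers. At m = 1 the coefficient vanishes, and O(1) = 16 against τ(1)
-- = 1 is the origin of the constant 16. The wall z = x + y is what confines the argument to odd m:
-- there 4m + 1 = (x + 2y)², so m = p(i + y) is even. Powers of 2 must therefore come from the
-- quaternions. If the norm is 2 mod 4, exactly two coordinates are odd, which gives three equally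
-- large classes of 8 τ(m) elements each; if 4 divides the norm, the congruence conditions hold
-- automatically and the count stays at 24 τ(m), whence the last factor 12.

record Enum {A : Set} (P : A → Set) : Set where
  field
    list     : List A
    unique   : Unique list
    sound    : ∀ {x} → x ∈ list → P x
    complete : ∀ {x} → P x → x ∈ list

open Enum

sumℤ : List ℤ → ℤ
sumℤ = foldr _+_ 0ℤ

∑ : {A : Set} {P : A → Set} → Enum P → (A → ℤ) → ℤ
∑ E f = sumℤ (map f (list E))

card : {A : Set} {P : A → Set} → Enum P → ℤ
card E = ∑ E (λ _ → 1ℤ)

card≡length : {A : Set} {P : A → Set} (E : Enum P) → card E ≡ + length (list E)
card≡length E = go (list E)
  where
  go : ∀ xs → sumℤ (map (λ _ → 1ℤ) xs) ≡ + length xs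
  go []       = refl
  go (_ ∷ xs) = cong (_+_ 1ℤ) (go xs)

module _ {A : Set} {P : A → Set} (E : Enum P) where

  ∑-cong : ∀ {f g : A → ℤ} → (∀ x → P x → f x ≡ g x) → ∑ E f ≡ ∑ E g
  ∑-cong {f} {g} f≗g = go (list E) (sound E)
    where
    go : ∀ xs → (∀ {x} → x ∈ xs → P x) → sumℤ (map f xs) ≡ sumℤ (map g xs)
    go []       h = refl
    go (x ∷ xs) h = cong₂ _+_ (f≗g x (h (here refl))) (go xs (h ∘ there))

  ∑-+ : ∀ (f g : A → ℤ) → ∑ E (λ x → f x + g x) ≡ ∑ E f + ∑ E g
  ∑-+ f g = go (list E)
    where
    interchange : ∀ a b c d → (a + b) + (c + d) ≡ (a + c) + (b + d)
    interchange = solve-∀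
    go : ∀ xs → sumℤ (map (λ x → f x + g x) xs) ≡ sumℤ (map f xs) + sumℤ (map g xs)
    go []       = refl
    go (x ∷ xs) = trans (cong (_+_ (f x + g x)) (go xs)) (interchange (f x) (g x) _ _)

  ∑-* : ∀ c (f : A → ℤ) → ∑ E (λ x → c * f x) ≡ c * ∑ E f
  ∑-* c f = go (list E)
    where
    go : ∀ xs → sumℤ (map (λ x → c * f x) xs) ≡ c * sumℤ (map f xs)
    go []       = sym (ℤ.*-zeroʳ c)
    go (x ∷ xs) = trans (cong (_+_ (c * f x)) (go xs)) (sym (ℤ.*-distribˡ-+ c (f x) _))

  ∑-neg : ∀ (f : A → ℤ) → ∑ E (λ x → - f x) ≡ - ∑ E f
  ∑-neg f = go (list E)
    where
    go : ∀ xs → sumℤ (map (λ x → - f x) xs) ≡ - sumℤ (map f xs)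
    go []       = refl
    go (x ∷ xs) = trans (cong (_+_ (- f x)) (go xs)) (sym (ℤ.neg-distrib-+ (f x) _))

  ∑-zero : ∀ {f : A → ℤ} → (∀ x → P x → f x ≡ 0ℤ) → ∑ E f ≡ 0ℤ
  ∑-zero {f} f≗0 = trans (∑-cong f≗0) (go (list E))
    where
    go : ∀ (xs : List A) → sumℤ (map (λ _ → 0ℤ) xs) ≡ 0ℤ
    go []       = refl
    go (_ ∷ xs) = trans (ℤ.+-identityˡ _) (go xs)

-- The inverse laws are required on members only, so the maps can be total functions with arbitrary
-- values elsewhere, as halving is below.
record _≅_ {A B : Set} (P : A → Set) (Q : B → Set) : Set where
  field
    to      : A → B
    from    : B → A
    to-∈    : ∀ x → P x → Q (to x)
    from-∈  : ∀ y → Q y → P (from y)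
    from∘to : ∀ x → P x → from (to x) ≡ x
    to∘from : ∀ y → Q y → to (from y) ≡ y

open _≅_

unique-map : {A B : Set} (f : A → B) (xs : List A) →
  (∀ {x y} → x ∈ xs → y ∈ xs → f x ≡ f y → x ≡ y) → Unique xs → Unique (map f xs)
unique-map f []       inj []          = []
unique-map f (x ∷ xs) inj (x∉xs ∷ uq) =
  All.map⁺ (All.tabulate λ y∈xs fx≡fy →
    All.lookup x∉xs y∈xs (inj (here refl) (there y∈xs) fx≡fy))
  ∷ unique-map f xs (λ u v → inj (there u) (there v)) uq

image : {A B : Set} {P : A → Set} {Q : B → Set} → P ≅ Q → Enum P → Enum Q
image {P = P} {Q} b E = record
  { list     = map (to b) (list E)
  ; unique   = unique-map (to b) (list E)
      (λ {x} {y} x∈ y∈ eq → trans (sym (from∘to b x (sound E x∈)))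
                      (trans (cong (from b) eq) (from∘to b y (sound E y∈))))
      (unique E)
  ; sound    = λ y∈ → let (x , x∈ , eq) = ∈-map⁻ (to b) y∈ in
      subst Q (sym eq) (to-∈ b x (sound E x∈))
  ; complete = λ {y} Qy → subst (_∈ map (to b) (list E)) (to∘from b y Qy)
      (∈-map⁺ (to b) (complete E (from-∈ b y Qy)))
  }

-- Two duplicate-free lists with the same members are permutations of each other, and addition is
-- commutative.
∑-independent : {A : Set} {P : A → Set} (E F : Enum P) (f : A → ℤ) → ∑ E f ≡ ∑ F f
∑-independent E F f = foldr-commMonoid (setoid ℤ) ℤ.+-0-isCommutativeMonoid
  (↭⇒↭ₛ (map⁺ f (∼bag⇒↭ (unique∧set⇒bag (unique E) (unique F)
    (mk⇔ (complete F ∘ sound E) (complete E ∘ sound F))))))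

∑-≅ : {A B : Set} {P : A → Set} {Q : B → Set} (E : Enum P) (F : Enum Q) (b : P ≅ Q)
  (f : B → ℤ) → ∑ E (f ∘ to b) ≡ ∑ F f
∑-≅ E F b f = trans (cong sumℤ (map-∘ (list E))) (∑-independent (image b E) F f)

-- This is the form in which the symmetry of the five odd squares is used, with `b` exchanging two
-- of the variables.
∑-invariant : {A : Set} {P : A → Set} (E : Enum P) (b : P ≅ P) (f : A → ℤ) →
  ∑ E (λ x → f (to b x) - f x) ≡ 0ℤ
∑-invariant E b f = begin
  ∑ E (λ x → f (to b x) - f x)            ≡⟨ ∑-+ E (f ∘ to b) (λ x → - f x) ⟩
  ∑ E (f ∘ to b) + ∑ E (λ x → - f x)      ≡⟨ cong₂ _+_ (∑-≅ E E b f) (∑-neg E f) ⟩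
  ∑ E f - ∑ E f                           ≡⟨ ℤ.+-inverseʳ (∑ E f) ⟩
  0ℤ                                      ∎
  where open ≡-Reasoning

card-≅ : {A B : Set} {P : A → Set} {Q : B → Set} (E : Enum P) (F : Enum Q) →
  P ≅ Q → card E ≡ card F
card-≅ E F b = ∑-≅ E F b (λ _ → 1ℤ)

same : {A : Set} {P Q : A → Set} → (∀ x → P x → Q x) → (∀ x → Q x → P x) → P ≅ Q
same P⊆Q Q⊆P = record
  { to = id ; from = id ; to-∈ = P⊆Q ; from-∈ = Q⊆P
  ; from∘to = λ _ _ → refl ; to∘from = λ _ _ → refl }

≅-trans : {A B C : Set} {P : A → Set} {Q : B → Set} {R : C → Set} → P ≅ Q → Q ≅ R → P ≅ R
≅-trans b c = record
  { to = to c ∘ to b ; from = from b ∘ from c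
  ; to-∈ = λ x Px → to-∈ c _ (to-∈ b x Px)
  ; from-∈ = λ z Rz → from-∈ b _ (from-∈ c z Rz)
  ; from∘to = λ x Px → trans (cong (from b) (from∘to c _ (to-∈ b x Px))) (from∘to b x Px)
  ; to∘from = λ z Rz → trans (cong (to c) (to∘from b _ (from-∈ c z Rz))) (to∘from c z Rz)
  }

≅-refine : {A B : Set} {P U : A → Set} {Q V : B → Set} (b : P ≅ Q) →
  (∀ x → P x → U x → V (to b x)) → (∀ y → Q y → V y → U (from b y)) →
  (λ x → P x × U x) ≅ (λ y → Q y × V y)
≅-refine b U⇒V V⇒U = record
  { to = to b ; from = from b
  ; to-∈ = λ x (Px , Ux) → to-∈ b x Px , U⇒V x Px Ux
  ; from-∈ = λ y (Qy , Vy) → from-∈ b y Qy , V⇒U y Qy Vy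
  ; from∘to = λ x (Px , _) → from∘to b x Px
  ; to∘from = λ y (Qy , _) → to∘from b y Qy
  }

restrict : {A : Set} {P U : A → Set} → Decidable U → Enum P → Enum (λ x → P x × U x)
restrict U? E = record
  { list     = filter U? (list E)
  ; unique   = Unique.filter⁺ U? (unique E)
  ; sound    = λ x∈ → let (x∈E , Ux) = ∈-filter⁻ U? x∈ in sound E x∈E , Ux
  ; complete = λ (Px , Ux) → ∈-filter⁺ U? (complete E Px) Ux
  }

∑-split : {A : Set} {P U : A → Set} (U? : Decidable U) (E : Enum P) (f : A → ℤ) →
  ∑ E f ≡ ∑ (restrict U? E) f + ∑ (restrict (λ x → ¬? (U? x)) E) f
∑-split U? E f = go (list E)
  where
  swap : ∀ a b c → a + (b + c) ≡ b + (a + c)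
  swap = solve-∀
  go : ∀ xs → sumℤ (map f xs) ≡
    sumℤ (map f (filter U? xs)) + sumℤ (map f (filter (λ x → ¬? (U? x)) xs))
  go [] = refl
  go (x ∷ xs) with U? x
  ... | yes _ = trans (cong (_+_ (f x)) (go xs)) (sym (ℤ.+-assoc (f x) _ _))
  ... | no  _ = trans (cong (_+_ (f x)) (go xs)) (swap (f x) (sumℤ (map f (filter U? xs))) _)

subEnum : {A : Set} {P Q : A → Set} → Decidable Q → (∀ x → Q x → P x) → Enum P → Enum Q
subEnum Q? Q⊆P E = image (same (λ _ → proj₂) (λ x q → Q⊆P x q , q)) (restrict Q? E)

module _ {A B : Set} {P : A → Set} {Q : A → B → Set} where

  private
    row : (∀ a → Enum (Q a)) → A → List (A × B)
    row F a = map (a ,_) (list (F a))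

  sigma : Enum P → (∀ a → Enum (Q a)) → Enum (λ ((a , b) : A × B) → P a × Q a b)
  sigma E F = record
    { list     = concat (map (row F) (list E))
    ; unique   = Unique.concat⁺
        (All.map⁺ (All.universal (λ a → Unique.map⁺ (λ { refl → refl }) (unique (F a))) (list E)))
        (AllPairs.map⁺ (AllPairs.map disjoint (unique E)))
    ; sound    = λ ab∈ → let (r , ab∈r , r∈) = ∈-concat⁻′ (map (row F) (list E)) ab∈
                             (a , a∈ , eq) = ∈-map⁻ (row F) r∈
                             (b , b∈ , eq′) = ∈-map⁻ (a ,_) (subst (_ ∈_) eq ab∈r) in
        subst (λ (a , b) → P a × Q a b) (sym eq′) (sound E a∈ , sound (F a) b∈)
    ; complete = λ { {a , b} (Pa , Qab) →
        ∈-concat⁺′ (∈-map⁺ (a ,_) (complete (F a) Qab)) (∈-map⁺ (row F) (complete E Pa)) }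
    }
    where
    disjoint : ∀ {a a′} → a ≢ a′ → ∀ {x} → ¬ (x ∈ row F a × x ∈ row F a′)
    disjoint a≢a′ (x∈ , x∈′) with ∈-map⁻ _ x∈ | ∈-map⁻ _ x∈′
    ... | _ , _ , refl | _ , _ , refl = a≢a′ refl

  ∑-sigma : (E : Enum P) (F : ∀ a → Enum (Q a)) (f : A × B → ℤ) →
    ∑ (sigma E F) f ≡ ∑ E (λ a → ∑ (F a) (λ b → f (a , b)))
  ∑-sigma E F f = go (list E)
    where
    sumℤ-++ : ∀ xs ys → sumℤ (xs ++ ys) ≡ sumℤ xs + sumℤ ys
    sumℤ-++ []       ys = sym (ℤ.+-identityˡ _)
    sumℤ-++ (x ∷ xs) ys = trans (cong (_+_ x) (sumℤ-++ xs ys)) (sym (ℤ.+-assoc x _ _))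
    go : ∀ as → sumℤ (map f (concat (map (row F) as))) ≡
      sumℤ (map (λ a → ∑ (F a) (λ b → f (a , b))) as)
    go []       = refl
    go (a ∷ as) = trans (cong sumℤ (map-++ f (row F a) _))
      (trans (sumℤ-++ (map f (row F a)) _)
        (cong₂ _+_ (cong sumℤ (sym (map-∘ (list (F a))))) (go as)))

box : ∀ n → Enum (λ i → ∣ i ∣ ℕ.≤ n)
box n = record
  { list     = map +_ (upTo (suc n)) ++ map -[1+_] (upTo n)
  ; unique   = Unique.++⁺ (Unique.map⁺ ℤ.+-injective (Unique.upTo⁺ (suc n)))
                          (Unique.map⁺ ℤ.-[1+-injective (Unique.upTo⁺ n))
                          disjoint
  ; sound    = snd
  ; complete = cmp
  }
  where
  disjoint : ∀ {x} → ¬ (x ∈ map +_ (upTo (suc n)) × x ∈ map -[1+_] (upTo n))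
  disjoint (x∈ , x∈′) with ∈-map⁻ +_ x∈ | ∈-map⁻ -[1+_] x∈′
  ... | _ , _ , refl | _ , _ , ()
  snd : ∀ {x} → x ∈ map +_ (upTo (suc n)) ++ map -[1+_] (upTo n) → ∣ x ∣ ℕ.≤ n
  snd x∈ with ∈-++⁻ (map +_ (upTo (suc n))) x∈
  ... | inj₁ u with ∈-map⁻ +_ u
  ...   | _ , k∈ , refl = ℕ.≤-pred (∈-upTo⁻ k∈)
  snd x∈ | inj₂ u with ∈-map⁻ -[1+_] u
  ...   | _ , k∈ , refl = ∈-upTo⁻ k∈
  cmp : ∀ {x} → ∣ x ∣ ℕ.≤ n → x ∈ map +_ (upTo (suc n)) ++ map -[1+_] (upTo n)
  cmp {+ k}      k≤n = ∈-++⁺ˡ (∈-map⁺ +_ (∈-upTo⁺ (ℕ.s≤s k≤n)))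
  cmp { -[1+ k ]} k<n = ∈-++⁺ʳ _ (∈-map⁺ -[1+_] (∈-upTo⁺ k<n))

-- Parity

Even Odd : ℤ → Set
Even x = + 2 ∣ x
Odd  x = + 2 ∣ x + 1ℤ

even∧odd : ∀ {x} → Even x → ¬ Odd x
even∧odd {x} e o = ℕ.>⇒∤ (ℕ.s≤s (ℕ.s≤s ℕ.z≤n)) (∣⇒∣ᵤ (subst (+ 2 ∣_) (lem x) (∣m∣n⇒∣m-n o e)))
  where
  lem : ∀ x → x + 1ℤ - x ≡ 1ℤ
  lem = solve-∀

shift : ∀ {x y} k → y ≡ x + k * + 2 → Even x → Even y
shift {x} k eq e = subst Even (sym eq) (∣m∣n⇒∣m+n e (divides k refl))

even⊎odd : ∀ x → Even x ⊎ Odd x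
even⊎odd (+ n) = pos n
  where
  lem : ∀ x → 1ℤ + x + 1ℤ ≡ x + 1ℤ * + 2
  lem = solve-∀
  pos : ∀ n → Even (+ n) ⊎ Odd (+ n)
  pos zero = inj₁ (divides 0ℤ refl)
  pos (suc n) with pos n
  ... | inj₁ e = inj₂ (shift 1ℤ (lem (+ n)) e)
  ... | inj₂ o = inj₁ (subst Even (ℤ.+-comm (+ n) 1ℤ) o)
even⊎odd -[1+ n ] with even⊎odd (+ n)
... | inj₁ e = inj₂ (subst Even (lem (+ n)) (∣m⇒∣-m e))
  where
  lem : ∀ x → - x ≡ - (1ℤ + x) + 1ℤ
  lem = solve-∀
... | inj₂ o = inj₁ (subst Even (cong -_ (ℤ.+-comm (+ n) 1ℤ)) (∣m⇒∣-m o))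

¬even⇒odd : ∀ {x} → ¬ Even x → Odd x
¬even⇒odd {x} ¬e with even⊎odd x
... | inj₁ e = contradiction e ¬e
... | inj₂ o = o

odd-sum⇒odd : ∀ x y → Odd (x + y) → Even y → Odd x
odd-sum⇒odd x y o e = subst Even (lem x y) (∣m∣n⇒∣m-n o e)
  where
  lem : ∀ x y → x + y + 1ℤ - y ≡ x + 1ℤ
  lem = solve-∀

odd+odd : ∀ x y → Odd x → Odd y → Even (x + y)
odd+odd x y o o′ = shift -1ℤ (lem x y) (∣m∣n⇒∣m+n o o′)
  where
  lem : ∀ x y → x + y ≡ x + 1ℤ + (y + 1ℤ) + -1ℤ * + 2
  lem = solve-∀

even-sum⇒odd : ∀ x y → Even (x + y) → Odd y → Odd x
even-sum⇒odd x y e o = shift 1ℤ (lem x y) (∣m∣n⇒∣m-n e o)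
  where
  lem : ∀ x y → x + 1ℤ ≡ x + y - (y + 1ℤ) + 1ℤ * + 2
  lem = solve-∀

odd-sum⇒even : ∀ x y → Odd (x + y) → Odd y → Even x
odd-sum⇒even x y o o′ = subst Even (lem x y) (∣m∣n⇒∣m-n o o′)
  where
  lem : ∀ x y → x + y + 1ℤ - (y + 1ℤ) ≡ x
  lem = solve-∀

-- The divisor recurrence

-- With x = 2i + 1 one has x² = 4 p(i) + 1.
p : ℤ → ℤ
p i = i * (i + 1ℤ)

p-even : ∀ i → Even (p i)
p-even i with even⊎odd i
... | inj₁ e = ∣m⇒∣m*n (i + 1ℤ) e
... | inj₂ o = ∣n⇒∣m*n i o

-- Both constructors give the same product because p(-1 - i) = p(i): the two arguments belong to x
-- and -x.
pℕ : ℤ → ℕ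
pℕ (+ n)    = n ℕ.* suc n
pℕ -[1+ n ] = n ℕ.* suc n

p≡+pℕ : ∀ i → p i ≡ + pℕ i
p≡+pℕ (+ n)         = trans (cong (λ k → + n * + k) (ℕ.+-comm n 1)) (sym (ℤ.pos-* n (suc n)))
p≡+pℕ -[1+ zero ]   = refl
p≡+pℕ -[1+ suc n ]  = cong +_ (ℕ.*-comm (suc (suc n)) (suc n))

0≤p : ∀ i → 0ℤ ≤ p i
0≤p i = subst (0ℤ ≤_) (sym (p≡+pℕ i)) (+≤+ ℕ.z≤n)

-- The added 1 is needed at i = -1, where p vanishes.
∣i∣≤1+pℕ : ∀ i → ∣ i ∣ ℕ.≤ suc (pℕ i)
∣i∣≤1+pℕ (+ n)    = ℕ.m≤n⇒m≤1+n (ℕ.m≤m*n n (suc n))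
∣i∣≤1+pℕ -[1+ n ] = ℕ.s≤s (ℕ.m≤m*n n (suc n))

∣i∣≤∣m∣ : ∀ {m} i → p i < m → ∣ i ∣ ℕ.≤ ∣ m ∣
∣i∣≤∣m∣ i pi<m with subst (_< _) (p≡+pℕ i) pi<m
... | +<+ q = ℕ.≤-trans (∣i∣≤1+pℕ i) q

p≡0 : Enum (λ i → p i ≡ 0ℤ)
p≡0 = record
  { list     = 0ℤ ∷ -1ℤ ∷ []
  ; unique   = ((λ ()) ∷ []) ∷ [] ∷ []
  ; sound    = λ { (here refl) → refl ; (there (here refl)) → refl }
  ; complete = λ {i} eq → cmp i (ℤ.+-injective (trans (sym (p≡+pℕ i)) eq))
  }
  where
  cmp : ∀ i → pℕ i ≡ 0 → i ∈ 0ℤ ∷ -1ℤ ∷ []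
  cmp (+ zero)   _ = here refl
  cmp -[1+ zero ] _ = there (here refl)

-- The common shape of the two recurrences: i encodes one odd square, and `X k` is either the
-- factorizations of k or the representations of 4k by four odd squares. Positivity of k = m - p(i)
-- bounds i and makes the total set finite.
module Slices {B : Set} (X : ℤ → B → Set) (F : ∀ k → Enum (X k))
              (X-positive : ∀ {k b} → X k b → 0ℤ < k) where

  Slice : ℤ → ℤ × B → Set
  Slice m (i , b) = X (m - p i) b

  private
    inBox : ∀ m i → 0ℤ < m - p i → ∣ i ∣ ℕ.≤ suc ∣ m ∣
    inBox m i 0<k = ℕ.m≤n⇒m≤1+n (∣i∣≤∣m∣ i (subst₂ _<_ (ℤ.+-identityˡ (p i)) (lem m (p i))
      (ℤ.+-monoˡ-< (p i) 0<k)))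
      where
      lem : ∀ m q → m - q + q ≡ m
      lem = solve-∀

    boxed : ∀ m → (λ ((i , b) : ℤ × B) → ∣ i ∣ ℕ.≤ suc ∣ m ∣ × X (m - p i) b) ≅ Slice m
    boxed m = same (λ _ → proj₂) (λ { (i , _) x → inBox m i (X-positive x) , x })

    -- The radius 1 + ∣ m ∣ ensures that the box always contains the two zeros 0 and -1 of p.
    pairs : ∀ m → Enum (λ ((i , b) : ℤ × B) → ∣ i ∣ ℕ.≤ suc ∣ m ∣ × X (m - p i) b)
    pairs m = sigma (box (suc ∣ m ∣)) (λ i → F (m - p i))

  slices : ∀ m → Enum (Slice m)
  slices m = image (boxed m) (pairs m)

  ∑-slices : ∀ m f → ∑ (slices m) f ≡
    ∑ (box (suc ∣ m ∣)) (λ i → ∑ (F (m - p i)) (λ b → f (i , b)))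
  ∑-slices m f = trans (sym (∑-≅ (pairs m) (slices m) (boxed m) f))
    (∑-sigma (box (suc ∣ m ∣)) (λ i → F (m - p i)) f)

T : ℤ → ℤ × ℤ → Set
T m (y , z) = 0ℤ < y × 0ℤ < z × y * z ≡ m

T-positive : ∀ {m} b → T m b → 0ℤ < m
T-positive (+ suc a , + suc b) (_ , _ , refl) = +<+ (ℕ.s≤s ℕ.z≤n)
T-positive (+ zero , _)   (+<+ () , _)
T-positive (+ suc a , + zero)   (_ , +<+ () , _)

enumT : ∀ m → Enum (T m)
enumT m = subEnum T? bound (sigma (box ∣ m ∣) (λ _ → box ∣ m ∣))
  where
  T? : Decidable (T m)
  T? (y , z) = (0ℤ ℤ.<? y) ×-dec (0ℤ ℤ.<? z) ×-dec (y * z ℤ.≟ m)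
  bound : ∀ b → T m b → ∣ proj₁ b ∣ ℕ.≤ ∣ m ∣ × ∣ proj₂ b ∣ ℕ.≤ ∣ m ∣
  bound (+ suc a , + suc b) (_ , _ , refl) = ℕ.m≤m*n (suc a) (suc b) , ℕ.m≤n*m (suc b) (suc a)
  bound (+ zero , _)   (+<+ () , _)
  bound (+ suc a , + zero)   (_ , +<+ () , _)

τ : ℤ → ℤ
τ m = ∑ (enumT m) proj₁

module ST = Slices T enumT (λ {_} {b} → T-positive b)

module _ (m : ℤ) (m-odd : Odd m) where

  private
    Triple : Set
    Triple = ℤ × ℤ × ℤ

    od : ℤ → ℤ
    od i = + 2 * i + 1ℤ

    S : Triple → Set
    S = ST.Slice m

    enumS : Enum S
    enumS = ST.slices m

    U : Triple → Set
    U (i , y , z) = od i + y < z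

    U? : Decidable U
    U? (i , y , z) = od i + y ℤ.<? z

    enumU : Enum (λ s → S s × U s)
    enumU = restrict U? enumS

    p-reflect : ∀ i → p (-1ℤ - i) ≡ p i
    p-reflect = lem
      where
      lem : ∀ i → (-1ℤ - i) * (-1ℤ - i + 1ℤ) ≡ i * (i + 1ℤ)
      lem = solve-∀

    reflect-involutive : ∀ i → -1ℤ - (-1ℤ - i) ≡ i
    reflect-involutive = solve-∀

    <-shift : ∀ {a b c d} k → a + k ≡ c → b + k ≡ d → a < b → c < d
    <-shift k refl refl = ℤ.+-monoˡ-< k

    -- z = x + y is impossible on S: it would make m ≡ y² + y (mod 2) even.
    z≢x+y : ∀ i y z → S (i , y , z) → z ≢ od i + y
    z≢x+y i y _ (_ , _ , eq) refl = even∧odd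
      (subst Even (trans (trans (lem₁ i y) (cong (λ w → w + p i) eq)) (lem₂ m (p i)))
        (∣m∣n⇒∣m+n (∣m∣n⇒∣m+n (p-even i) (p-even y)) (divides (y * i) refl)))
      m-odd
      where
      lem₁ : ∀ i y → i * (i + 1ℤ) + y * (y + 1ℤ) + y * i * + 2 ≡
        y * (+ 2 * i + 1ℤ + y) + i * (i + 1ℤ)
      lem₁ = solve-∀
      lem₂ : ∀ m q → m - q + q ≡ m
      lem₂ = solve-∀

    -- In terms of x = 2i + 1, the index -1 - i stands for -x, and -1 - i - y stands for -x - 2y.
    θ ρ ψ : Triple → Triple
    θ (i , y , z) = -1ℤ - i , z , y
    ρ (i , y , z) = -1ℤ - i , y , z
    ψ (i , y , z) = -1ℤ - i - y , y , z - od i - y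

    θ-∈ : ∀ s → S s → S (θ s)
    θ-∈ (i , y , z) (0<y , 0<z , eq) =
      0<z , 0<y , trans (ℤ.*-comm z y) (trans eq (cong (_-_ m) (sym (p-reflect i))))

    ρ-≅ : S ≅ S
    ρ-≅ = record
      { to = ρ ; from = ρ ; to-∈ = ρ-∈ ; from-∈ = ρ-∈
      ; from∘to = λ { (i , _) _ → cong (_, _) (reflect-involutive i) }
      ; to∘from = λ { (i , _) _ → cong (_, _) (reflect-involutive i) } }
      where
      ρ-∈ : ∀ s → S s → S (ρ s)
      ρ-∈ (i , y , z) (0<y , 0<z , eq) = 0<y , 0<z , trans eq (cong (_-_ m) (sym (p-reflect i)))

    -- The inequality x + y < z becomes z′ < x′ + y′. That is exactly the complement of `U` because
    -- equality never occurs on `S`.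
    θ-≅ : (λ s → S s × U s) ≅ (λ s → S s × ¬ U s)
    θ-≅ = record
      { to = θ ; from = θ
      ; to-∈ = λ { (i , y , z) (s , u) → θ-∈ (i , y , z) s , λ u′ →
          ℤ.<-asym u (<-shift _ (lem₁ i z) (ℤ.+-comm y _) u′) }
      ; from-∈ = λ { (i , y , z) (s , ¬u) → θ-∈ (i , y , z) s , U-θ i y z s ¬u }
      ; from∘to = λ { (i , _) _ → cong (_, _) (reflect-involutive i) }
      ; to∘from = λ { (i , _) _ → cong (_, _) (reflect-involutive i) } }
      where
      lem₁ : ∀ i z → + 2 * (-1ℤ - i) + 1ℤ + z + (+ 2 * i + 1ℤ) ≡ z
      lem₁ = solve-∀
      lem₂ : ∀ i y → + 2 * i + 1ℤ + y + (+ 2 * (-1ℤ - i) + 1ℤ) ≡ y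
      lem₂ = solve-∀
      U-θ : ∀ i y z → S (i , y , z) → ¬ U (i , y , z) → U (θ (i , y , z))
      U-θ i y z s ¬u with ℤ.<-cmp (od i + y) z
      ... | tri< u _ _ = contradiction u ¬u
      ... | tri≈ _ e _ = contradiction (sym e) (z≢x+y i y z s)
      ... | tri> _ _ z< = <-shift _ (ℤ.+-comm z _) (lem₂ i y) z<

    -- The conditions z > 0 and z > x + y change places: z′ = z - x - y, and conversely z′ - x′ - y′
    -- = z.
    ψ-≅ : (λ s → S s × U s) ≅ (λ s → S s × U s)
    ψ-≅ = record
      { to = ψ ; from = ψ ; to-∈ = ψ-∈ ; from-∈ = ψ-∈ ; from∘to = inv ; to∘from = inv }
      where
      lem₁ : ∀ i y z → y * (z - (+ 2 * i + 1ℤ) - y) ≡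
        y * z + i * (i + 1ℤ) - (-1ℤ - i - y) * (-1ℤ - i - y + 1ℤ)
      lem₁ = solve-∀
      lem₂ : ∀ m q r → m - q + q - r ≡ m - r
      lem₂ = solve-∀
      lem₃ : ∀ i y z → z + (+ 2 * (-1ℤ - i - y) + 1ℤ + y) ≡ z - (+ 2 * i + 1ℤ) - y
      lem₃ = solve-∀
      lem₄ : ∀ i y → (+ 2 * i + 1ℤ) + y + (- (+ 2 * i + 1ℤ) - y) ≡ 0ℤ
      lem₄ = solve-∀
      lem₅ : ∀ z x y → z + (- x - y) ≡ z - x - y
      lem₅ = solve-∀
      lem₆ : ∀ i y → -1ℤ - (-1ℤ - i - y) - y ≡ i
      lem₆ = solve-∀
      lem₇ : ∀ i y z → z - (+ 2 * i + 1ℤ) - y - (+ 2 * (-1ℤ - i - y) + 1ℤ) - y ≡ z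
      lem₇ = solve-∀
      ψ-∈ : ∀ s → S s × U s → S (ψ s) × U (ψ s)
      ψ-∈ (i , y , z) ((0<y , 0<z , eq) , u) =
        (0<y , <-shift (- od i - y) (lem₄ i y) (lem₅ z (od i) y) u
        , trans (lem₁ i y z) (trans (cong (λ w → w + p i - p (-1ℤ - i - y)) eq)
            (lem₂ m (p i) (p (-1ℤ - i - y)))))
        , <-shift (od (-1ℤ - i - y) + y) (ℤ.+-identityˡ _) (lem₃ i y z) 0<z
      inv : ∀ s → S s × U s → ψ (ψ s) ≡ s
      inv (i , y , z) _ = cong₂ (λ i z → i , y , z) (lem₆ i y) (lem₇ i y z)

    -- K is odd in x, so it sums to 0 over S; it is the correction that makes H below
    -- antisymmetric under ψ.
    G K : Triple → ℤ
    G (i , y , z) = y * (y * z - (od i * od i))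
    K (i , y , z) = od i * (y * y)

    x≡-x⇒x≡0 : ∀ {x} → x ≡ - x → x ≡ 0ℤ
    x≡-x⇒x≡0 {+ zero}  _ = refl

    ∑K≡0 : ∑ enumS K ≡ 0ℤ
    ∑K≡0 = x≡-x⇒x≡0 (trans (sym (∑-≅ enumS enumS ρ-≅ K))
      (trans (∑-cong enumS (λ { (i , y , z) _ → lem i y })) (∑-neg enumS K)))
      where
      lem : ∀ i y → (+ 2 * (-1ℤ - i) + 1ℤ) * (y * y) ≡ - ((+ 2 * i + 1ℤ) * (y * y))
      lem = solve-∀

    H : Triple → ℤ
    H s = G s - K s + (G (θ s) - K (θ s))

    -- `H` factors as (x + y)(y + z)(z - x). Under `ψ` the first factor changes sign and the other
    -- two are interchanged, so `H` is negated.
    ∑H≡0 : ∑ enumU H ≡ 0ℤ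
    ∑H≡0 = x≡-x⇒x≡0 (trans (sym (∑-≅ enumU enumU ψ-≅ H))
      (trans (∑-cong enumU (λ { (i , y , z) _ → lem i y z })) (∑-neg enumU H)))
      where
      lem : ∀ i y z →
        let x  = + 2 * i + 1ℤ
            x′ = + 2 * (-1ℤ - i - y) + 1ℤ
            z′ = z - x - y
            -x  = + 2 * (-1ℤ - i) + 1ℤ
            -x′ = + 2 * (-1ℤ - (-1ℤ - i - y)) + 1ℤ
        in  y * (y * z′ - x′ * x′) - x′ * (y * y) + (z′ * (z′ * y - -x′ * -x′) - -x′ * (z′ * z′))
          ≡ - (y * (y * z - x * x) - x * (y * y) + (z * (z * y - -x * -x) - -x * (z * z)))
      lem = solve-∀

    ∑G≡0 : ∑ enumS G ≡ 0ℤ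
    ∑G≡0 = begin
      ∑ enumS G                                  ≡⟨ ∑-cong enumS (λ s _ → lem (G s) (K s)) ⟩
      ∑ enumS (λ s → GK s + K s)                 ≡⟨ ∑-+ enumS GK K ⟩
      ∑ enumS GK + ∑ enumS K                     ≡⟨ cong₂ _+_ (∑-split U? enumS GK) ∑K≡0 ⟩
      ∑ enumU GK + ∑ enumV GK + 0ℤ               ≡⟨ ℤ.+-identityʳ _ ⟩
      -- Folding the complementary region back by `θ` turns the sum over all of `S` into the sum of
      -- `H` over `U`.
      ∑ enumU GK + ∑ enumV GK                    ≡⟨ cong (_+_ (∑ enumU GK)) (∑-≅ enumU enumV θ-≅ GK) ⟨
      ∑ enumU GK + ∑ enumU (GK ∘ θ)              ≡⟨ ∑-+ enumU GK (GK ∘ θ) ⟨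
      ∑ enumU H                                  ≡⟨ ∑H≡0 ⟩
      0ℤ                                         ∎
      where
      open ≡-Reasoning
      GK : Triple → ℤ
      GK s = G s - K s
      enumV : Enum (λ s → S s × ¬ U s)
      enumV = restrict (λ s → ¬? (U? s)) enumS
      lem : ∀ g k → g ≡ g - k + k
      lem = solve-∀

  ∑τ≡0 : ∑ (box (suc ∣ m ∣)) (λ i → (m - 1ℤ - + 5 * p i) * τ (m - p i)) ≡ 0ℤ
  ∑τ≡0 = begin
    ∑ B (λ i → c i * τ (m - p i))
      ≡⟨ ∑-cong B (λ i _ → ∑-* (enumT (m - p i)) (c i) proj₁) ⟨
    ∑ B (λ i → ∑ (enumT (m - p i)) (λ (y , z) → c i * y))
      ≡⟨ ST.∑-slices m (λ (i , y , z) → c i * y) ⟨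
    ∑ enumS (λ (i , y , z) → c i * y)
      ≡⟨ ∑-cong enumS (λ { (i , y , z) (_ , _ , eq) →
           trans (lem m i y) (cong (λ w → y * (w - od i * od i)) (sym eq)) }) ⟩
    ∑ enumS G
      ≡⟨ ∑G≡0 ⟩
    0ℤ ∎
    where
    open ≡-Reasoning
    B = box (suc ∣ m ∣)
    c : ℤ → ℤ
    c i = m - 1ℤ - + 5 * p i
    lem : ∀ m i y → (m - 1ℤ - + 5 * (i * (i + 1ℤ))) * y ≡
      y * (m - i * (i + 1ℤ) - (+ 2 * i + 1ℤ) * (+ 2 * i + 1ℤ))
    lem = solve-∀

-- Four odd squares

quads : {P : ℤ → Set} → Enum P → Enum (λ (quat a b c d) → P a × P b × P c × P d)
quads {P} E = image tuple (sigma E (λ _ → sigma E (λ _ → sigma E (λ _ → E))))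
  where
  tuple : (λ ((a , b , c , d) : ℤ × ℤ × ℤ × ℤ) → P a × P b × P c × P d) ≅
          (λ (quat a b c d) → P a × P b × P c × P d)
  tuple = record
    { to = λ (a , b , c , d) → quat a b c d ; from = λ (quat a b c d) → a , b , c , d
    ; to-∈ = λ _ x → x ; from-∈ = λ _ x → x ; from∘to = λ _ _ → refl ; to∘from = λ _ _ → refl }

summands≤sum : ∀ a b c d → let s = a ℕ.+ b ℕ.+ c ℕ.+ d in
  a ℕ.≤ s × b ℕ.≤ s × c ℕ.≤ s × d ℕ.≤ s
summands≤sum a b c d =
    ℕ.≤-trans (ℕ.m≤m+n a b) a+b≤s
  , ℕ.≤-trans (ℕ.m≤n+m b a) a+b≤s
  , ℕ.≤-trans (ℕ.m≤n+m c (a ℕ.+ b)) (ℕ.m≤m+n _ d)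
  , ℕ.m≤n+m d (a ℕ.+ b ℕ.+ c)
  where
  a+b≤s : a ℕ.+ b ℕ.≤ a ℕ.+ b ℕ.+ c ℕ.+ d
  a+b≤s = ℕ.≤-trans (ℕ.m≤m+n _ c) (ℕ.m≤m+n _ d)

-- (2a+1)² + (2b+1)² + (2c+1)² + (2d+1)² = 4m
O : ℤ → Quat → Set
O m (quat a b c d) = p a + p b + p c + p d + 1ℤ ≡ m

∑pℕ : Quat → ℕ
∑pℕ (quat a b c d) = pℕ a ℕ.+ pℕ b ℕ.+ pℕ c ℕ.+ pℕ d

O⇒≡ : ∀ {m} q → O m q → m ≡ + (∑pℕ q ℕ.+ 1)
O⇒≡ (quat a b c d) eq = trans (sym eq) (cong (_+ 1ℤ)
  (cong₂ _+_ (cong₂ _+_ (cong₂ _+_ (p≡+pℕ a) (p≡+pℕ b)) (p≡+pℕ c)) (p≡+pℕ d)))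

O-positive : ∀ {m} q → O m q → 0ℤ < m
O-positive q o = subst (0ℤ <_) (sym (O⇒≡ q o)) (+<+ (ℕ.m≤n+m 1 (∑pℕ q)))

enumO : ∀ m → Enum (O m)
enumO m = subEnum (λ (quat a b c d) → p a + p b + p c + p d + 1ℤ ℤ.≟ m) bound
  (quads (box ∣ m ∣))
  where
  bound : ∀ q → O m q → let quat a b c d = q in
    ∣ a ∣ ℕ.≤ ∣ m ∣ × ∣ b ∣ ℕ.≤ ∣ m ∣ × ∣ c ∣ ℕ.≤ ∣ m ∣ × ∣ d ∣ ℕ.≤ ∣ m ∣
  bound q@(quat a b c d) o =
    let (a≤ , b≤ , c≤ , d≤) = summands≤sum (pℕ a) (pℕ b) (pℕ c) (pℕ d)
    in entry a a≤ , entry b b≤ , entry c c≤ , entry d d≤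
    where
    entry : ∀ i → pℕ i ℕ.≤ ∑pℕ q → ∣ i ∣ ℕ.≤ ∣ m ∣
    entry i le = ℕ.≤-trans (∣i∣≤1+pℕ i) (subst (suc (pℕ i) ℕ.≤_)
      (trans (ℕ.+-comm 1 (∑pℕ q)) (sym (cong ∣_∣ (O⇒≡ q o)))) (ℕ.s≤s le))

module SO = Slices O enumO (λ {_} {q} → O-positive q)

module _ (m : ℤ) where

  private
    W : ℤ × Quat → Set
    W = SO.Slice m

    enumW : Enum W
    enumW = SO.slices m

    involution : (f : ℤ × Quat → ℤ × Quat) → (∀ w → W w → W (f w)) → (∀ w → f (f w) ≡ w) → W ≅ W
    involution f f-∈ ff = record { to = f ; from = f ; to-∈ = f-∈ ; from-∈ = f-∈
                                 ; from∘to = λ w _ → ff w ; to∘from = λ w _ → ff w }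

    exchange : ∀ {s s′} i a → s′ ≡ s + (i - a) → s ≡ m - i → s′ ≡ m - a
    exchange i a refl refl = lem m i a
      where
      lem : ∀ m i a → m - i + (i - a) ≡ m - a
      lem = solve-∀

    swapA swapB swapC swapD : W ≅ W
    swapA = involution (λ (i , quat a b c d) → a , quat i b c d)
      (λ (i , quat a b c d) → exchange (p i) (p a) (lem (p i) (p a) (p b) (p c) (p d))) (λ _ → refl)
      where
      lem : ∀ i a b c d → i + b + c + d + 1ℤ ≡ a + b + c + d + 1ℤ + (i - a)
      lem = solve-∀
    swapB = involution (λ (i , quat a b c d) → b , quat a i c d)
      (λ (i , quat a b c d) → exchange (p i) (p b) (lem (p i) (p a) (p b) (p c) (p d))) (λ _ → refl)
      where
      lem : ∀ i a b c d → a + i + c + d + 1ℤ ≡ a + b + c + d + 1ℤ + (i - b)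
      lem = solve-∀
    swapC = involution (λ (i , quat a b c d) → c , quat a b i d)
      (λ (i , quat a b c d) → exchange (p i) (p c) (lem (p i) (p a) (p b) (p c) (p d))) (λ _ → refl)
      where
      lem : ∀ i a b c d → a + b + i + d + 1ℤ ≡ a + b + c + d + 1ℤ + (i - c)
      lem = solve-∀
    swapD = involution (λ (i , quat a b c d) → d , quat a b c i)
      (λ (i , quat a b c d) → exchange (p i) (p d) (lem (p i) (p a) (p b) (p c) (p d))) (λ _ → refl)
      where
      lem : ∀ i a b c d → a + b + c + i + 1ℤ ≡ a + b + c + d + 1ℤ + (i - d)
      lem = solve-∀

    c : ℤ → ℤ
    c i = m - 1ℤ - + 5 * p i

    δ : W ≅ W → ℤ × Quat → ℤ
    δ f w = p (proj₁ (to f w)) - p (proj₁ w)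

    ∑δ≡0 : ∀ f → ∑ enumW (δ f) ≡ 0ℤ
    ∑δ≡0 f = ∑-invariant enumW f (p ∘ proj₁)

  -- Since p(a) + p(b) + p(c) + p(d) + 1 = m - p(i), the weight m - 1 - 5 p(i) is the sum of the
  -- four differences p(a) - p(i), ..., p(d) - p(i). Each of them sums to zero by exchanging i with
  -- that variable.
  ∑O≡0 : ∑ (box (suc ∣ m ∣)) (λ i → (m - 1ℤ - + 5 * p i) * card (enumO (m - p i))) ≡ 0ℤ
  ∑O≡0 = begin
    ∑ B (λ i → c i * card (enumO (m - p i)))
      ≡⟨ ∑-cong B (λ i _ → ∑-* (enumO (m - p i)) (c i) (λ _ → 1ℤ)) ⟨
    ∑ B (λ i → ∑ (enumO (m - p i)) (λ _ → c i * 1ℤ))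
      ≡⟨ SO.∑-slices m (λ (i , _) → c i * 1ℤ) ⟨
    ∑ enumW (λ (i , _) → c i * 1ℤ)
      ≡⟨ ∑-cong enumW (λ (i , quat a b c d) eq →
           lem m (p i) (p a) (p b) (p c) (p d) eq) ⟩
    ∑ enumW (λ w → δ swapA w + δ swapB w + δ swapC w + δ swapD w)
      ≡⟨ ∑-+ enumW _ (δ swapD) ⟩
    ∑ enumW (λ w → δ swapA w + δ swapB w + δ swapC w) + ∑ enumW (δ swapD)
      ≡⟨ cong₂ _+_ (∑-+ enumW _ (δ swapC)) (∑δ≡0 swapD) ⟩
    ∑ enumW (λ w → δ swapA w + δ swapB w) + ∑ enumW (δ swapC) + 0ℤ
      ≡⟨ cong (_+ 0ℤ) (cong₂ _+_ (∑-+ enumW (δ swapA) (δ swapB)) (∑δ≡0 swapC)) ⟩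
    ∑ enumW (δ swapA) + ∑ enumW (δ swapB) + 0ℤ + 0ℤ
      ≡⟨ cong (λ s → s + 0ℤ + 0ℤ) (cong₂ _+_ (∑δ≡0 swapA) (∑δ≡0 swapB)) ⟩
    0ℤ ∎
    where
    open ≡-Reasoning
    B = box (suc ∣ m ∣)
    ring₁ : ∀ m i → (m - 1ℤ - + 5 * i) * 1ℤ ≡ m - i - 1ℤ - + 4 * i
    ring₁ = solve-∀
    ring₂ : ∀ i a b c d → a + b + c + d + 1ℤ - 1ℤ - + 4 * i ≡ (a - i) + (b - i) + (c - i) + (d - i)
    ring₂ = solve-∀
    lem : ∀ m i a b c d → a + b + c + d + 1ℤ ≡ m - i →
      (m - 1ℤ - + 5 * i) * 1ℤ ≡ (a - i) + (b - i) + (c - i) + (d - i)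
    lem m i a b c d eq = trans (ring₁ m i)
      (trans (cong (λ k → k - 1ℤ - + 4 * i) (sym eq)) (ring₂ i a b c d))

-- Both sides satisfy one linear recurrence, so their difference `D` does too. As p takes even
-- values, the recurrence at an odd m involves only odd arguments, and strong induction applies.
O≡16τ : ∀ m → Odd m → card (enumO m) ≡ + 16 * τ m
O≡16τ m m-odd = ℤ.i-j≡0⇒i≡j (card (enumO m)) (+ 16 * τ m) (below (suc ∣ m ∣) m (m<1+∣m∣ m) m-odd)
  where
  D : ℤ → ℤ
  D k = card (enumO k) - + 16 * τ k

  m<1+∣m∣ : ∀ m → m < + suc ∣ m ∣
  m<1+∣m∣ (+ n)    = +<+ ℕ.≤-refl
  m<1+∣m∣ -[1+ n ] = -<+

  ∑D≡0 : ∀ m → Odd m → ∑ (box (suc ∣ m ∣)) (λ i → (m - 1ℤ - + 5 * p i) * D (m - p i)) ≡ 0ℤ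
  ∑D≡0 m m-odd = begin
    ∑ B (λ i → (m - 1ℤ - + 5 * p i) * D (m - p i))
      ≡⟨ ∑-cong B (λ i _ → lem (m - 1ℤ - + 5 * p i) (card (enumO (m - p i))) (τ (m - p i))) ⟩
    ∑ B (λ i → fO i + - + 16 * fτ i)
      ≡⟨ ∑-+ B fO (λ i → - + 16 * fτ i) ⟩
    ∑ B fO + ∑ B (λ i → - + 16 * fτ i)
      ≡⟨ cong₂ _+_ (∑O≡0 m) (trans (∑-* B (- + 16) fτ) (cong (_*_ (- + 16)) (∑τ≡0 m m-odd))) ⟩
    0ℤ ∎
    where
    open ≡-Reasoning
    B = box (suc ∣ m ∣)
    fO fτ : ℤ → ℤ
    fO i = (m - 1ℤ - + 5 * p i) * card (enumO (m - p i))
    fτ i = (m - 1ℤ - + 5 * p i) * τ (m - p i)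
    lem : ∀ c o t → c * (o - + 16 * t) ≡ c * o + - + 16 * (c * t)
    lem = solve-∀

  -- In the recurrence only i = 0 and i = -1 contribute m itself.
  leading : ∀ m → Odd m → (∀ k → k < m → Odd k → D k ≡ 0ℤ) →
    ∑ (box (suc ∣ m ∣)) (λ i → (m - 1ℤ - + 5 * p i) * D (m - p i)) ≡ + 2 * (m - 1ℤ) * D m
  leading m m-odd ih = collapsed
    where
    B = box (suc ∣ m ∣)
    g : ℤ → ℤ
    g i = (m - 1ℤ - + 5 * p i) * D (m - p i)
    Z? : Decidable (λ i → p i ≡ 0ℤ)
    Z? i = p i ℤ.≟ 0ℤ
    inBox : ∀ i → p i ≡ 0ℤ → ∣ i ∣ ℕ.≤ suc ∣ m ∣
    inBox i eq = ℕ.≤-trans (∣i∣≤1+pℕ i)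
      (ℕ.s≤s (subst (ℕ._≤ ∣ m ∣) (sym (ℤ.+-injective (trans (sym (p≡+pℕ i)) eq))) ℕ.z≤n))
    vanish : ∀ i → p i ≢ 0ℤ → g i ≡ 0ℤ
    vanish i pi≢0 = trans
      (cong (_*_ (m - 1ℤ - + 5 * p i)) (ih (m - p i) m-pi<m m-pi-odd))
      (ℤ.*-zeroʳ (m - 1ℤ - + 5 * p i))
      where
      m-pi<m : m - p i < m
      m-pi<m = subst (m - p i <_) (ℤ.+-identityʳ m)
        (ℤ.+-monoʳ-< m (ℤ.neg-mono-< (ℤ.≤∧≢⇒< (0≤p i) (pi≢0 ∘ sym))))
      lem : ∀ m q → m + 1ℤ - q ≡ m - q + 1ℤ
      lem = solve-∀
      m-pi-odd : Odd (m - p i)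
      m-pi-odd = subst Even (lem m (p i)) (∣m∣n⇒∣m-n m-odd (p-even i))
    collapsed : ∑ B g ≡ + 2 * (m - 1ℤ) * D m
    collapsed = begin
      ∑ B g
        ≡⟨ ∑-split Z? B g ⟩
      ∑ (restrict Z? B) g + ∑ (restrict (λ i → ¬? (Z? i)) B) g
        ≡⟨ cong₂ _+_ (∑-≅ (restrict Z? B) p≡0 (same (λ _ → proj₂) (λ i eq → inBox i eq , eq)) g)
             (∑-zero (restrict (λ i → ¬? (Z? i)) B) (λ i → vanish i ∘ proj₂)) ⟩
      g 0ℤ + (g -1ℤ + 0ℤ) + 0ℤ
        ≡⟨ cong (λ k → (m - 1ℤ - 0ℤ) * D k + ((m - 1ℤ - 0ℤ) * D k + 0ℤ) + 0ℤ) (ℤ.+-identityʳ m) ⟩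
      (m - 1ℤ - 0ℤ) * D m + ((m - 1ℤ - 0ℤ) * D m + 0ℤ) + 0ℤ
        ≡⟨ lem m (D m) ⟩
      + 2 * (m - 1ℤ) * D m ∎
      where
      open ≡-Reasoning
      lem : ∀ m d → (m - 1ℤ - 0ℤ) * d + ((m - 1ℤ - 0ℤ) * d + 0ℤ) + 0ℤ ≡ + 2 * (m - 1ℤ) * d
      lem = solve-∀

  -- Once the smaller terms vanish, the recurrence reads 2(m - 1) D(m) = 0, and ℤ has no zero
  -- divisors.
  step : ∀ m → m ≢ 1ℤ → Odd m → (∀ k → k < m → Odd k → D k ≡ 0ℤ) → D m ≡ 0ℤ
  step m m≢1 m-odd ih = [ (λ eq → contradiction (m≡1 eq) m≢1) , id ]′
    (ℤ.i*j≡0⇒i≡0∨j≡0 (+ 2 * (m - 1ℤ)) (trans (sym (leading m m-odd ih)) (∑D≡0 m m-odd)))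
    where
    m≡1 : + 2 * (m - 1ℤ) ≡ 0ℤ → m ≡ 1ℤ
    m≡1 eq = ℤ.i-j≡0⇒i≡j m 1ℤ (ℤ.*-cancelˡ-≡ (+ 2) (m - 1ℤ) 0ℤ eq)

  below : ∀ n m → m < + n → Odd m → D m ≡ 0ℤ
  below zero m m<0 _ = cong₂ _-_
    (∑-zero (enumO m) (λ q o → contradiction (O-positive q o) (ℤ.<-asym m<0)))
    (cong (_*_ (+ 16)) (∑-zero (enumT m) (λ b t → contradiction (T-positive b t) (ℤ.<-asym m<0))))
  below (suc n) m m<1+n m-odd = byCases (m ℤ.≟ 1ℤ)
    where
    byCases : Dec (m ≡ 1ℤ) → D m ≡ 0ℤ
    -- The recurrence leaves D(1) undetermined; here `refl` evaluates both enumerations, to 16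
    -- solutions and to τ(1) = 1.
    byCases (yes m≡1) = subst (λ k → D k ≡ 0ℤ) (sym m≡1) refl
    byCases (no m≢1)  = step m m≢1 m-odd
      (λ k k<m → below n k (ℤ.<-≤-trans k<m (ℤ.i<j⇒i≤pred[j] m<1+n)))

-- Norms of integral quaternions

cancel2 : ∀ x y → x * + 2 ≡ y * + 2 → x ≡ y
cancel2 x y = ℤ.*-cancelʳ-≡ x y (+ 2)

-- Evenness is tested rather than passed as an argument, so that inverse maps built from it are
-- total; 0 is a placeholder on odd numbers.
half : ℤ → ℤ
half x with even⊎odd x
... | inj₁ e = quotient e
... | inj₂ _ = 0ℤ

half*2 : ∀ {x} → Even x → half x * + 2 ≡ x
half*2 {x} e with even⊎odd x
... | inj₁ (divides q eq) = sym eq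
... | inj₂ o = contradiction o (even∧odd e)

half-unique : ∀ {x} k → x ≡ k * + 2 → half x ≡ k
half-unique {x} k eq = cancel2 (half x) k (trans (half*2 (divides k eq)) eq)

even-sum⇒even-diff : ∀ x y → Even (x + y) → Even (x - y)
even-sum⇒even-diff x y = shift (- y) (lem x y)
  where
  lem : ∀ x y → x - y ≡ x + y + - y * + 2
  lem = solve-∀

half-sum : ∀ x y → Even (x + y) → half (x + y) + half (x - y) ≡ x
half-sum x y e = cancel2 _ x (trans (ℤ.*-distribʳ-+ (+ 2) (half (x + y)) (half (x - y)))
  (trans (cong₂ _+_ (half*2 e) (half*2 (even-sum⇒even-diff x y e))) (lem x y)))
  where
  lem : ∀ x y → x + y + (x - y) ≡ x * + 2
  lem = solve-∀

half-diff : ∀ x y → Even (x + y) → half (x + y) - half (x - y) ≡ y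
half-diff x y e = cancel2 _ y (trans (lem₁ (half (x + y)) (half (x - y)))
  (trans (cong₂ _-_ (half*2 e) (half*2 (even-sum⇒even-diff x y e))) (lem₂ x y)))
  where
  lem₁ : ∀ u v → (u - v) * + 2 ≡ u * + 2 - v * + 2
  lem₁ = solve-∀
  lem₂ : ∀ x y → x + y - (x - y) ≡ y * + 2
  lem₂ = solve-∀

N : ℤ → Quat → Set
N n q = nrd q ≡ n

enumN : ∀ n → Enum (N n)
enumN n = subEnum (λ q → nrd q ℤ.≟ n) bound (quads (box ∣ n ∣))
  where
  sqℕ : ℤ → ℕ
  sqℕ a = ∣ a ∣ ℕ.* ∣ a ∣
  sq : ∀ a → a * a ≡ + sqℕ a
  sq (+ k)    = sym (ℤ.pos-* k k)
  sq -[1+ k ] = refl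
  bound : ∀ q → N n q → let quat a b c d = q in
    ∣ a ∣ ℕ.≤ ∣ n ∣ × ∣ b ∣ ℕ.≤ ∣ n ∣ × ∣ c ∣ ℕ.≤ ∣ n ∣ × ∣ d ∣ ℕ.≤ ∣ n ∣
  bound (quat a b c d) eq =
    let (a≤ , b≤ , c≤ , d≤) = summands≤sum (sqℕ a) (sqℕ b) (sqℕ c) (sqℕ d)
    in entry a a≤ , entry b b≤ , entry c c≤ , entry d d≤
    where
    total : ∣ n ∣ ≡ sqℕ a ℕ.+ sqℕ b ℕ.+ sqℕ c ℕ.+ sqℕ d
    total = cong ∣_∣ (trans (sym eq)
      (cong₂ _+_ (cong₂ _+_ (cong₂ _+_ (sq a) (sq b)) (sq c)) (sq d)))
    n≤n² : ∀ k → k ℕ.≤ k ℕ.* k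
    n≤n² zero    = ℕ.z≤n
    n≤n² (suc k) = ℕ.m≤m*n (suc k) (suc k)
    entry : ∀ i → sqℕ i ℕ.≤ sqℕ a ℕ.+ sqℕ b ℕ.+ sqℕ c ℕ.+ sqℕ d → ∣ i ∣ ℕ.≤ ∣ n ∣
    entry i le = ℕ.≤-trans (n≤n² ∣ i ∣) (subst (sqℕ i ℕ.≤_) (sym total) le)

-- Parity classes of the coordinates and multiplication by 1 + 𝐢

c∼d b∼d : Quat → Set
c∼d (quat a b c d) = Even (c + d)
b∼d (quat a b c d) = Even (b + d)

N₂ : ℤ → Quat → Set
N₂ n q = N n q × c∼d q

c∼d? : Decidable c∼d
c∼d? (quat a b c d) = + 2 ∣? c + d

enumN₂ : ∀ n → Enum (N₂ n)
enumN₂ n = restrict c∼d? (enumN n)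

enumN₂ᶜ : ∀ n → Enum (λ q → N n q × ¬ c∼d q)
enumN₂ᶜ n = restrict (λ q → ¬? (c∼d? q)) (enumN n)

card-N-split : ∀ n → card (enumN n) ≡ card (enumN₂ n) + card (enumN₂ᶜ n)
card-N-split n = ∑-split c∼d? (enumN n) (λ _ → 1ℤ)

∑p-even : ∀ a b c d → Even (p a + p b + p c + p d)
∑p-even a b c d = ∣m∣n⇒∣m+n (∣m∣n⇒∣m+n (∣m∣n⇒∣m+n (p-even a) (p-even b)) (p-even c)) (p-even d)

-- As every p is even, the norm and the sum of the coordinates have the same parity.
∑p≡nrd+∑ : ∀ a b c d → p a + p b + p c + p d ≡ nrd (quat a b c d) + (a + b + c + d)
∑p≡nrd+∑ = lem
  where
  lem : ∀ a b c d → a * (a + 1ℤ) + b * (b + 1ℤ) + c * (c + 1ℤ) + d * (d + 1ℤ) ≡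
    a * a + b * b + c * c + d * d + (a + b + c + d)
  lem = solve-∀

even-norm : ∀ {n} a b c d → Even n → N n (quat a b c d) → Even (a + b + c + d)
even-norm a b c d n-even refl = ∣m+n∣m⇒∣n (subst Even (∑p≡nrd+∑ a b c d) (∑p-even a b c d)) n-even

odd-norm : ∀ {n} a b c d → Odd n → N n (quat a b c d) → Odd (a + b + c + d)
odd-norm a b c d n-odd refl = even-sum⇒odd (a + b + c + d) (nrd (quat a b c d))
  (subst Even (trans (∑p≡nrd+∑ a b c d) (ℤ.+-comm (nrd (quat a b c d)) (a + b + c + d)))
    (∑p-even a b c d)) n-odd

pairs-even : ∀ a b c d → Even (a + b + c + d) → Even (c + d) → Even (a + b)
pairs-even a b c d e = ∣m+n∣n⇒∣m (subst Even (ℤ.+-assoc (a + b) c d) e)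

-- Left multiplication by 1 + 𝐢 up to signs; it doubles the norm.
N≅N₂ : ∀ k → N k ≅ N₂ (k * + 2)
N≅N₂ k = record
  { to = H ; from = H⁻¹ ; to-∈ = H-∈ ; from-∈ = H⁻¹-∈ ; from∘to = λ q _ → H⁻¹H q ; to∘from = HH⁻¹ }
  where
  H H⁻¹ : Quat → Quat
  H (quat a b c d) = quat (a + b) (a - b) (c + d) (c - d)
  H⁻¹ (quat a b c d) = quat (half (a + b)) (half (a - b)) (half (c + d)) (half (c - d))
  nrd-H : ∀ q → nrd (H q) ≡ nrd q * + 2
  nrd-H (quat a b c d) = lem a b c d
    where
    lem : ∀ a b c d → (a + b) * (a + b) + (a - b) * (a - b) + (c + d) * (c + d) + (c - d) * (c - d)
      ≡ (a * a + b * b + c * c + d * d) * + 2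
    lem = solve-∀
  s+d : ∀ x y → x + y + (x - y) ≡ x * + 2
  s+d = solve-∀
  s-d : ∀ x y → x + y - (x - y) ≡ y * + 2
  s-d = solve-∀
  H-∈ : ∀ q → N k q → N₂ (k * + 2) (H q)
  H-∈ q@(quat a b c d) eq = trans (nrd-H q) (cong (_* + 2) eq) , divides c (s+d c d)
  HH⁻¹ : ∀ q → N₂ (k * + 2) q → H (H⁻¹ q) ≡ q
  HH⁻¹ (quat a b c d) (eq , cd) =
    trans (cong₂ (λ u v → quat u v _ _) (half-sum a b ab) (half-diff a b ab))
          (cong₂ (quat a b) (half-sum c d cd) (half-diff c d cd))
    where
    -- Membership gives the congruence for the pair c, d only; the even norm supplies it for a, b.
    ab : Even (a + b)
    ab = pairs-even a b c d (even-norm a b c d (divides k refl) eq) cd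
  H⁻¹-∈ : ∀ q → N₂ (k * + 2) q → N k (H⁻¹ q)
  H⁻¹-∈ q x@(eq , _) = cancel2 _ k (trans (sym (nrd-H (H⁻¹ q))) (trans (cong nrd (HH⁻¹ q x)) eq))
  H⁻¹H : ∀ q → H⁻¹ (H q) ≡ q
  H⁻¹H (quat a b c d) =
    trans (cong₂ (λ u v → quat u v _ _) (half-unique a (s+d a b)) (half-unique b (s-d a b)))
          (cong₂ (quat a b) (half-unique c (s+d c d)) (half-unique d (s-d c d)))

-- With w = x + y + 1 even and y = w - (x + 1), everything reduces to x² + (x + 1)² = 1 + 2 p(x),
-- where p(x) is even.
odd-pair : ∀ x y → Odd (x + y) → ∃ λ k → x * x + y * y ≡ 1ℤ + k * + 4
odd-pair x y (divides s eq) = h + (s * s - s - s * x) , trans (lem₁ x y)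
  (trans (cong₂ (λ u v → 1ℤ + u * + 2 + v * v - + 2 * (v * (x + 1ℤ)))
      (_∣_.equality (p-even x)) eq)
    (lem₂ h s x))
  where
  h : ℤ
  h = quotient (p-even x)
  lem₁ : ∀ x y → x * x + y * y ≡
    1ℤ + x * (x + 1ℤ) * + 2 + (x + y + 1ℤ) * (x + y + 1ℤ) - + 2 * ((x + y + 1ℤ) * (x + 1ℤ))
  lem₁ = solve-∀
  lem₂ : ∀ h s x → 1ℤ + h * + 2 * + 2 + s * + 2 * (s * + 2) - + 2 * (s * + 2 * (x + 1ℤ)) ≡
    1ℤ + (h + (s * s - s - s * x)) * + 4
  lem₂ = solve-∀

-- If c + d were odd, a + b would be odd as well; each pair of squares would be 1 mod 4 and the norm
-- 2 mod 4.
norm-4k⇒c∼d : ∀ k q → N (k * + 2 * + 2) q → c∼d q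
norm-4k⇒c∼d k (quat a b c d) eq = [ id , (λ o → ⊥-elim (absurd o)) ]′ (even⊎odd (c + d))
  where
  2≢4k : ∀ u v → ¬ k * + 2 * + 2 ≡ 1ℤ + u * + 4 + (1ℤ + v * + 4)
  2≢4k u v e = even∧odd {1ℤ} (divides (k - u - v) (sym (cancel2 ((k - u - v) * + 2) 1ℤ
    (ℤ.i-j≡0⇒i≡j _ _ (trans (sym (lem k u v)) (ℤ.i≡j⇒i-j≡0 e)))))) (divides 1ℤ refl)
    where
    lem : ∀ k u v → k * + 2 * + 2 - (1ℤ + u * + 4 + (1ℤ + v * + 4)) ≡
      (k - u - v) * + 2 * + 2 - 1ℤ * + 2
    lem = solve-∀
  absurd : Odd (c + d) → ⊥
  absurd o = let
      (u , eq₁) = odd-pair a b (even-sum⇒odd (a + b) (c + d) (subst Even (ℤ.+-assoc (a + b) c d)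
                    (even-norm a b c d (divides (k * + 2) refl) eq)) o)
      (v , eq₂) = odd-pair c d o
    in 2≢4k u v (trans (sym eq) (trans (ℤ.+-assoc (a * a + b * b) (c * c) (d * d)) (cong₂ _+_ eq₁ eq₂)))

-- At norm 4k the condition cutting out the image of multiplication by 1 + 𝐢 is automatic, so that
-- map is a bijection from norm 2k onto norm 4k.
card-N-4k : ∀ k → card (enumN (k * + 2 * + 2)) ≡ card (enumN (k * + 2))
card-N-4k k = sym (card-≅ (enumN (k * + 2)) (enumN (k * + 2 * + 2))
  (≅-trans (N≅N₂ (k * + 2)) (same (λ _ → proj₁) (λ q x → x , norm-4k⇒c∼d k q x))))

module _ (m : ℤ) (m-odd : Odd m) where
  private
    even-sum : ∀ q → N (m * + 2) q → let quat a b c d = q in Even (a + b + c + d)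
    even-sum (quat a b c d) = even-norm a b c d (divides m refl)

    -- Writing a = (a + d) - d, and likewise for b and c, turns the norm into `form`, which is
    -- divisible by 4 when its three arguments are even, whereas 2m is not.
    same-parity-norm≢2m : ∀ a b c d → Even (a + d) → Even (b + d) → Even (c + d) →
      nrd (quat a b c d) ≢ m * + 2
    same-parity-norm≢2m a b c d (divides α eq-α) (divides β eq-β) (divides γ eq-γ) eq =
      even∧odd (divides Q (cancel2 m (Q * + 2) (begin
        m * + 2                                  ≡⟨ eq ⟨
        nrd (quat a b c d)                       ≡⟨ lem₁ a b c d ⟩
        form (a + d) (b + d) (c + d)             ≡⟨ cong (λ u → form u (b + d) (c + d)) eq-α ⟩
        form (α * + 2) (b + d) (c + d)           ≡⟨ cong₂ (form (α * + 2)) eq-β eq-γ ⟩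
        form (α * + 2) (β * + 2) (γ * + 2)       ≡⟨ lem₂ α β γ d ⟩
        Q * + 2 * + 2                            ∎))) m-odd
      where
      open ≡-Reasoning
      form : ℤ → ℤ → ℤ → ℤ
      form u v w = u * u + v * v + w * w + + 4 * (d * d) - + 2 * (d * (u + v + w))
      Q : ℤ
      Q = α * α + β * β + γ * γ + d * d - d * (α + β + γ)
      lem₁ : ∀ a b c d → a * a + b * b + c * c + d * d ≡
        (a + d) * (a + d) + (b + d) * (b + d) + (c + d) * (c + d) + + 4 * (d * d)
        - + 2 * (d * (a + d + (b + d) + (c + d)))
      lem₁ = solve-∀
      lem₂ : ∀ α β γ d →
        α * + 2 * (α * + 2) + β * + 2 * (β * + 2) + γ * + 2 * (γ * + 2) + + 4 * (d * d)
        - + 2 * (d * (α * + 2 + β * + 2 + γ * + 2)) ≡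
        (α * α + β * β + γ * γ + d * d - d * (α + β + γ)) * + 2 * + 2
      lem₂ = solve-∀

    -- Since the coordinate sum is even, two agreements in parity with d would force the third.
    exclusive : ∀ q → N (m * + 2) q → c∼d q → ¬ b∼d q
    exclusive (quat a b c d) eq cd bd = same-parity-norm≢2m a b c d
      (shift d (lem a b c d) (∣m∣n⇒∣m-n (∣m∣n⇒∣m-n (even-sum (quat a b c d) eq) cd) bd)) bd cd eq
      where
      lem : ∀ a b c d → a + d ≡ a + b + c + d - (c + d) - (b + d) + d * + 2
      lem = solve-∀

    b↔c a↔c : Quat → Quat
    b↔c (quat a b c d) = quat a c b d
    a↔c (quat a b c d) = quat c b a d

    nrd-b↔c : ∀ q → nrd (b↔c q) ≡ nrd q
    nrd-b↔c (quat a b c d) = lem (a * a) (b * b) (c * c) (d * d)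
      where
      lem : ∀ a b c d → a + c + b + d ≡ a + b + c + d
      lem = solve-∀

    nrd-a↔c : ∀ q → nrd (a↔c q) ≡ nrd q
    nrd-a↔c (quat a b c d) = lem (a * a) (b * b) (c * c) (d * d)
      where
      lem : ∀ a b c d → c + b + a + d ≡ a + b + c + d
      lem = solve-∀

    b∼d? : Decidable b∼d
    b∼d? (quat a b c d) = + 2 ∣? b + d

    M = m * + 2

    E₁ = restrict b∼d? (enumN₂ᶜ M)
    E₂ = restrict (λ q → ¬? (b∼d? q)) (enumN₂ᶜ M)

    N₂≅b∼d : N₂ M ≅ (λ q → (N M q × ¬ c∼d q) × b∼d q)
    N₂≅b∼d = record
      { to = b↔c ; from = b↔c
      ; to-∈ = λ q (eq , cd) → (trans (nrd-b↔c q) eq , exclusive q eq cd) , cd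
      ; from-∈ = λ q ((eq , _) , bd) → trans (nrd-b↔c q) eq , bd
      ; from∘to = λ _ _ → refl ; to∘from = λ _ _ → refl }

    -- The last two conditions mean a ∼ d, since a + b + c + d is even.
    N₂≅a∼d : N₂ M ≅ (λ q → (N M q × ¬ c∼d q) × ¬ b∼d q)
    N₂≅a∼d = record
      { to = a↔c ; from = a↔c
      ; to-∈ = λ { q@(quat a b c d) (eq , cd) →
          (trans (nrd-a↔c q) eq
          , (λ ad → exclusive q eq cd (bd-of-ad q eq cd ad)))
          , exclusive q eq cd }
      ; from-∈ = λ { q@(quat a b c d) ((eq , ¬cd) , ¬bd) →
          trans (nrd-a↔c q) eq
          , subst Even (lem₂ a b c d) (∣m∣n⇒∣m-n
              (∣m∣n⇒∣m+n (even-sum q eq) (divides d refl))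
              (odd+odd (c + d) (b + d) (¬even⇒odd ¬cd) (¬even⇒odd ¬bd))) }
      ; from∘to = λ _ _ → refl ; to∘from = λ _ _ → refl }
      where
      lem₁ : ∀ a b c d → b + d ≡ a + b + c + d - (c + d) - (a + d) + d * + 2
      lem₁ = solve-∀
      lem₂ : ∀ a b c d → a + b + c + d + d * + 2 - (c + d + (b + d)) ≡ a + d
      lem₂ = solve-∀
      bd-of-ad : ∀ q → N M q → c∼d q → let quat a b c d = q in Even (a + d) → b∼d q
      bd-of-ad q@(quat a b c d) eq cd ad =
        shift d (lem₁ a b c d) (∣m∣n⇒∣m-n (∣m∣n⇒∣m-n (even-sum q eq) cd) ad)

  -- Exactly two coordinates are odd, so d shares its parity with exactly one of a, b, c.
  -- Transpositions match the three cases with each other; c is the case excluded here, and each of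
  -- the other two has as many elements as norm m.
  card-N₂ᶜ : card (enumN₂ᶜ (m * + 2)) ≡ + 2 * card (enumN m)
  card-N₂ᶜ = begin
    card (enumN₂ᶜ M)                 ≡⟨ ∑-split b∼d? (enumN₂ᶜ M) (λ _ → 1ℤ) ⟩
    card E₁ + card E₂                ≡⟨ cong₂ _+_ (card-≅ (enumN m) E₁ (≅-trans (N≅N₂ m) N₂≅b∼d))
                                          (card-≅ (enumN m) E₂ (≅-trans (N≅N₂ m) N₂≅a∼d)) ⟨
    card (enumN m) + card (enumN m)  ≡⟨ lem (card (enumN m)) ⟩
    + 2 * card (enumN m)             ∎
    where
    open ≡-Reasoning
    lem : ∀ x → x + x ≡ + 2 * x
    lem = solve-∀

-- `F` applies the map of `N≅N₂` to the odd coordinates 2a + 1, 2b + 1, 2c + 1, 2d + 1 and halves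
-- the result, taking norm 4m to 2m. The last two coordinates of the image add up to the odd number
-- 2c + 1.
O≅N₂ᶜ : ∀ m → O m ≅ (λ q → N (m * + 2) q × ¬ c∼d q)
O≅N₂ᶜ m = record
  { to = F ; from = F⁻¹ ; to-∈ = F-∈ ; from-∈ = F⁻¹-∈ ; from∘to = λ q _ → F⁻¹F q ; to∘from = FF⁻¹ }
  where
  F F⁻¹ : Quat → Quat
  F (quat a b c d) = quat (a + b + 1ℤ) (a - b) (c + d + 1ℤ) (c - d)
  F⁻¹ (quat a b c d) = quat (half (a - 1ℤ + b)) (half (a - 1ℤ - b))
                            (half (c - 1ℤ + d)) (half (c - 1ℤ - d))
  O-form : Quat → ℤ
  O-form (quat a b c d) = p a + p b + p c + p d + 1ℤ
  nrd-F : ∀ q → nrd (F q) ≡ O-form q * + 2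
  nrd-F (quat a b c d) = lem a b c d
    where
    lem : ∀ a b c d →
      (a + b + 1ℤ) * (a + b + 1ℤ) + (a - b) * (a - b) + (c + d + 1ℤ) * (c + d + 1ℤ) + (c - d) * (c - d)
      ≡ (a * (a + 1ℤ) + b * (b + 1ℤ) + c * (c + 1ℤ) + d * (d + 1ℤ) + 1ℤ) * + 2
    lem = solve-∀
  s+d : ∀ x y → x + y + 1ℤ - 1ℤ + (x - y) ≡ x * + 2
  s+d = solve-∀
  s-d : ∀ x y → x + y + 1ℤ - 1ℤ - (x - y) ≡ y * + 2
  s-d = solve-∀
  odd-s+d : ∀ x y → x + y + 1ℤ + (x - y) + 1ℤ ≡ (x + 1ℤ) * + 2
  odd-s+d = solve-∀
  F-∈ : ∀ q → O m q → N (m * + 2) (F q) × ¬ c∼d (F q)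
  F-∈ q@(quat a b c d) eq = trans (nrd-F q) (cong (_* + 2) eq)
    , λ e → even∧odd e (divides (c + 1ℤ) (odd-s+d c d))
  odd⇒even-pred : ∀ x y → Odd (x + y) → Even (x - 1ℤ + y)
  odd⇒even-pred x y = shift -1ℤ (lem x y)
    where
    lem : ∀ x y → x - 1ℤ + y ≡ x + y + 1ℤ + -1ℤ * + 2
    lem = solve-∀
  pred+1 : ∀ x → x - 1ℤ + 1ℤ ≡ x
  pred+1 = solve-∀
  FF⁻¹ : ∀ q → N (m * + 2) q × ¬ c∼d q → F (F⁻¹ q) ≡ q
  FF⁻¹ (quat a b c d) (eq , ¬cd) =
    trans (cong₂ (λ u v → quat (u + 1ℤ) v _ _) (half-sum (a - 1ℤ) b ab) (half-diff (a - 1ℤ) b ab))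
   (trans (cong₂ (λ u v → quat _ b (u + 1ℤ) v) (half-sum (c - 1ℤ) d cd) (half-diff (c - 1ℤ) d cd))
          (cong₂ (λ u v → quat u b v d) (pred+1 a) (pred+1 c)))
    where
    cd : Even (c - 1ℤ + d)
    cd = odd⇒even-pred c d (¬even⇒odd ¬cd)
    ab : Even (a - 1ℤ + b)
    ab = odd⇒even-pred a b (even-sum⇒odd (a + b) (c + d)
      (subst Even (ℤ.+-assoc (a + b) c d) (even-norm a b c d (divides m refl) eq)) (¬even⇒odd ¬cd))
  F⁻¹-∈ : ∀ q → N (m * + 2) q × ¬ c∼d q → O m (F⁻¹ q)
  F⁻¹-∈ q x@(eq , _) = cancel2 _ m (trans (sym (nrd-F (F⁻¹ q))) (trans (cong nrd (FF⁻¹ q x)) eq))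
  F⁻¹F : ∀ q → F⁻¹ (F q) ≡ q
  F⁻¹F (quat a b c d) =
    trans (cong₂ (λ u v → quat u v _ _) (half-unique a (s+d a b)) (half-unique b (s-d a b)))
          (cong₂ (quat a b) (half-unique c (s+d c d)) (half-unique d (s-d c d)))

-- 𝒢 with the coordinates in the order t, y, x, z.
G : ℤ → Quat → Set
G n q = N₂ n q × Even (Quat.x q)

enumG : ∀ n → Enum (G n)
enumG n = restrict (λ q → + 2 ∣? Quat.x q) (enumN₂ n)

swapPairs : Quat → Quat
swapPairs (quat a b c d) = quat c d a b

swapPairs-≅ : ∀ n → N n ≅ N n
swapPairs-≅ n = record
  { to = swapPairs ; from = swapPairs
  ; to-∈ = mem ; from-∈ = mem
  ; from∘to = λ _ _ → refl ; to∘from = λ _ _ → refl }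
  where
  lem : ∀ a b c d → c + d + a + b ≡ a + b + c + d
  lem = solve-∀
  mem : ∀ q → N n q → N n (swapPairs q)
  mem (quat a b c d) eq = trans (lem (a * a) (b * b) (c * c) (d * d)) eq

-- Multiplication by 1 + 𝐢 puts the difference of the first pair in second place. Swapping the pairs
-- beforehand makes that entry c - d, so `c∼d` becomes the evenness required by `G`.
N₂≅G : ∀ k → N₂ k ≅ G (k * + 2)
N₂≅G k = ≅-refine (≅-trans (swapPairs-≅ k) (N≅N₂ k))
  (λ { (quat a b c d) _ → even-sum⇒even-diff c d })
  (λ { (quat a b c d) (eq , cd) b-even →
       let ab = pairs-even a b c d (even-norm a b c d (divides k refl) eq) cd
       in subst Even (sym (half-sum a b ab)) (∣m+n∣n⇒∣m ab b-even) })

-- Counts at norm 2^e m for odd m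

infix 8 2^_·_

2^_·_ : ℕ → ℤ → ℤ
2^ zero  · m = m
2^ suc e · m = (2^ e · m) * + 2

double : ∀ x → x + x ≡ + 2 * x
double = solve-∀

module _ (m : ℤ) (m-odd : Odd m) where

  -- The coordinate sum is odd, so exactly one of a + b and c + d is even, and swapping the pairs
  -- exchanges the two cases.
  card-N≡2*N₂ : card (enumN m) ≡ + 2 * card (enumN₂ m)
  card-N≡2*N₂ = trans (card-N-split m) (trans
    (cong (_+_ (card (enumN₂ m))) (sym (card-≅ (enumN₂ m) (enumN₂ᶜ m) swapped)))
    (double (card (enumN₂ m))))
    where
    odd-pairs : ∀ a b c d → N m (quat a b c d) → Odd (a + b + (c + d))
    odd-pairs a b c d eq = subst Odd (ℤ.+-assoc (a + b) c d) (odd-norm a b c d m-odd eq)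
    swapped : N₂ m ≅ (λ q → N m q × ¬ c∼d q)
    swapped = ≅-refine (swapPairs-≅ m)
      (λ { (quat a b c d) eq cd ab → even∧odd {a + b} ab
           (odd-sum⇒odd (a + b) (c + d) (odd-pairs a b c d eq) cd) })
      (λ { (quat a b c d) eq ¬ab →
           odd-sum⇒even (a + b) (c + d) (odd-pairs a b c d eq) (¬even⇒odd ¬ab) })

  -- With c + d even, a + b is odd, so exactly one of a and b is even; exchanging them matches the
  -- cases.
  card-N₂≡2*G : card (enumN₂ m) ≡ + 2 * card (enumG m)
  card-N₂≡2*G = trans (∑-split (λ q → + 2 ∣? Quat.x q) (enumN₂ m) (λ _ → 1ℤ))
    (trans (cong (_+_ (card (enumG m))) (sym (card-≅ (enumG m)
        (restrict (λ q → ¬? (+ 2 ∣? Quat.x q)) (enumN₂ m)) swapped)))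
      (double (card (enumG m))))
    where
    a↔b : Quat → Quat
    a↔b (quat a b c d) = quat b a c d
    lem : ∀ a b c d → b + a + c + d ≡ a + b + c + d
    lem = solve-∀
    mem : ∀ q → N₂ m q → N₂ m (a↔b q)
    mem (quat a b c d) (eq , cd) = trans (lem (a * a) (b * b) (c * c) (d * d)) eq , cd
    odd-ab : ∀ a b c d → N₂ m (quat a b c d) → Odd (a + b)
    odd-ab a b c d (eq , cd) = odd-sum⇒odd (a + b) (c + d)
      (subst Odd (ℤ.+-assoc (a + b) c d) (odd-norm a b c d m-odd eq)) cd
    swapped : G m ≅ (λ q → N₂ m q × ¬ Even (Quat.x q))
    swapped = ≅-refine (record { to = a↔b ; from = a↔b ; to-∈ = mem ; from-∈ = mem
                               ; from∘to = λ _ _ → refl ; to∘from = λ _ _ → refl })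
      (λ { (quat a b c d) x b-even a-even →
           even∧odd a-even (odd-sum⇒odd a b (odd-ab a b c d x) b-even) })
      (λ { (quat a b c d) x ¬b → odd-sum⇒even a b (odd-ab a b c d x) (¬even⇒odd ¬b) })

  -- The elements of norm 2m with c + d odd are counted in two ways, as 2 r(m) for r(m) the number
  -- of elements of norm m, and as O(m).
  card-N : card (enumN m) ≡ + 8 * τ m
  card-N = ℤ.*-cancelˡ-≡ (+ 2) _ _ (begin
    + 2 * card (enumN m)       ≡⟨ card-N₂ᶜ m m-odd ⟨
    card (enumN₂ᶜ (m * + 2))   ≡⟨ card-≅ (enumO m) (enumN₂ᶜ (m * + 2)) (O≅N₂ᶜ m) ⟨
    card (enumO m)             ≡⟨ O≡16τ m m-odd ⟩
    + 16 * τ m                 ≡⟨ lem (τ m) ⟩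
    + 2 * (+ 8 * τ m)          ∎)
    where
    open ≡-Reasoning
    lem : ∀ t → + 16 * t ≡ + 2 * (+ 8 * t)
    lem = solve-∀

  card-N₂ : card (enumN₂ m) ≡ + 4 * τ m
  card-N₂ = ℤ.*-cancelˡ-≡ (+ 2) _ _ (trans (sym card-N≡2*N₂) (trans card-N (lem (τ m))))
    where
    lem : ∀ t → + 8 * t ≡ + 2 * (+ 4 * t)
    lem = solve-∀

  card-N-2m : card (enumN (m * + 2)) ≡ + 24 * τ m
  card-N-2m = begin
    card (enumN (m * + 2))
      ≡⟨ card-N-split (m * + 2) ⟩
    card (enumN₂ (m * + 2)) + card (enumN₂ᶜ (m * + 2))
      ≡⟨ cong₂ _+_ (sym (card-≅ (enumN m) (enumN₂ (m * + 2)) (N≅N₂ m))) (card-N₂ᶜ m m-odd) ⟩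
    card (enumN m) + + 2 * card (enumN m)
      ≡⟨ cong (λ k → k + + 2 * k) card-N ⟩
    + 8 * τ m + + 2 * (+ 8 * τ m)
      ≡⟨ lem (τ m) ⟩
    + 24 * τ m ∎
    where
    open ≡-Reasoning
    lem : ∀ t → + 8 * t + + 2 * (+ 8 * t) ≡ + 24 * t
    lem = solve-∀

  card-N-2^e*m : ∀ e → card (enumN (2^ suc e · m)) ≡ + 24 * τ m
  card-N-2^e*m zero    = card-N-2m
  card-N-2^e*m (suc e) = trans (card-N-4k (2^ e · m)) (card-N-2^e*m e)

  -- One factor 1 + 𝐢 can be removed for e = 1 and two for e ≥ 2, leaving all quaternions of norm
  -- 2^(e-2) m in the latter case. The counts 4τ, 8τ and 24τ are 2τ times 2, 4 and 12.
  card-G : ∀ e → card (enumG (2^ e · m)) ≡ + 2 * τ m * + factor e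
  card-G 0 = ℤ.*-cancelˡ-≡ (+ 2) _ _ (trans (sym card-N₂≡2*G) (trans card-N₂ (lem (τ m))))
    where
    lem : ∀ t → + 4 * t ≡ + 2 * (+ 2 * t * 1ℤ)
    lem = solve-∀
  card-G 1 = trans (sym (card-≅ (enumN₂ m) (enumG (m * + 2)) (N₂≅G m))) (trans card-N₂ (lem (τ m)))
    where
    lem : ∀ t → + 4 * t ≡ + 2 * t * + 2
    lem = solve-∀
  card-G 2 = trans (sym (card-≅ (enumN m) (enumG (m * + 2 * + 2))
    (≅-trans (N≅N₂ m) (N₂≅G (m * + 2))))) (trans card-N (lem (τ m)))
    where
    lem : ∀ t → + 8 * t ≡ + 2 * t * + 4
    lem = solve-∀
  card-G (suc (suc (suc e))) =
    trans (sym (card-≅ (enumN k) (enumG (k * + 2 * + 2)) (≅-trans (N≅N₂ k) (N₂≅G (k * + 2)))))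
      (trans (card-N-2^e*m e) (lem (τ m)))
    where
    k = 2^ suc e · m
    lem : ∀ t → + 24 * t ≡ + 2 * t * + 12
    lem = solve-∀

-- Odd divisors and the order 𝒢

+2^e*m : ∀ e m → + (2 ℕ.^ e ℕ.* m) ≡ 2^ e · + m
+2^e*m zero    m = cong +_ (ℕ.*-identityˡ m)
+2^e*m (suc e) m = trans (cong +_ (trans (ℕ.*-assoc 2 (2 ℕ.^ e) m) (ℕ.*-comm 2 (2 ℕ.^ e ℕ.* m))))
  (trans (ℤ.pos-* (2 ℕ.^ e ℕ.* m) 2) (cong (_* + 2) (+2^e*m e m)))

%2≡1⇒odd : ∀ m → m % 2 ≡ 1 → Odd (+ m)
%2≡1⇒odd m eq = divides (+ suc (m / 2)) (begin
  + m + 1ℤ                             ≡⟨ cong (λ k → + k + 1ℤ) (m≡m%n+[m/n]*n m 2) ⟩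
  + (m % 2 ℕ.+ m / 2 ℕ.* 2) + 1ℤ       ≡⟨ cong (λ k → + (k ℕ.+ m / 2 ℕ.* 2) + 1ℤ) eq ⟩
  + suc (m / 2 ℕ.* 2) + 1ℤ             ≡⟨ cong +_ (ℕ.+-comm (suc (m / 2 ℕ.* 2)) 1) ⟩
  + (suc (m / 2) ℕ.* 2)                ≡⟨ ℤ.pos-* (suc (m / 2)) 2 ⟩
  + suc (m / 2) * + 2                  ∎)
  where open ≡-Reasoning

oddℕ : ∀ d → d % 2 ≡ 1 ⊎ 2 ℕ.∣ d
oddℕ d with d % 2 in eq | m%n<n d 2
... | 0 | _ = inj₂ (ℕ.m%n≡0⇒n∣m d 2 eq)
... | 1 | _ = inj₁ refl
... | suc (suc _) | ℕ.s≤s (ℕ.s≤s ())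

%2≡1⇒2∤ : ∀ {d} → d % 2 ≡ 1 → ¬ 2 ℕ.∣ d
%2≡1⇒2∤ {d} eq 2∣d with trans (sym eq) (ℕ.n∣m⇒m%n≡0 d 2 2∣d)
... | ()

odd∣2^e*m⇒∣m : ∀ {d} e m → d % 2 ≡ 1 → d ℕ.∣ 2 ℕ.^ e ℕ.* m → d ℕ.∣ m
odd∣2^e*m⇒∣m {d} e m d-odd d∣ = coprime-divisor (coprime e) d∣
  where
  coprime : ∀ e → Coprime d (2 ℕ.^ e)
  coprime zero    (_ , k∣1) = ℕ.∣1⇒≡1 k∣1
  coprime (suc e) {k} (k∣d , k∣2^1+e) = coprime e (k∣d , coprime-divisor k⊥2 k∣2^1+e)
    where
    k⊥2 : Coprime k 2
    k⊥2 {0} (_ , 0∣2) = contradiction (ℕ.0∣⇒≡0 0∣2) λ ()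
    k⊥2 {1} _ = refl
    k⊥2 {2} (2∣k , _) = contradiction (ℕ.∣-trans 2∣k k∣d) (%2≡1⇒2∤ d-odd)
    k⊥2 {suc (suc (suc _))} (_ , j∣2) with ℕ.∣⇒≤ j∣2
    ... | ℕ.s≤s (ℕ.s≤s ())

OddDivisor : ℕ → ℕ → Set
OddDivisor n d = d ℕ.∣ n × d % 2 ≡ 1

enumOddDivisor : ∀ n → .{{_ : ℕ.NonZero n}} → Enum (OddDivisor n)
enumOddDivisor n = record
  { list     = filter D? (map suc (upTo n))
  ; unique   = Unique.filter⁺ D? (Unique.map⁺ ℕ.suc-injective (Unique.upTo⁺ n))
  ; sound    = λ d∈ → proj₂ (∈-filter⁻ D? {xs = map suc (upTo n)} d∈)
  ; complete = λ {d} x → cmp d x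
  }
  where
  D? : Decidable (OddDivisor n)
  D? d = (d ℕ.∣? n) ×-dec (d % 2 ℕ.≟ 1)
  cmp : ∀ d → OddDivisor n d → d ∈ filter D? (map suc (upTo n))
  cmp (suc d) x@(d∣n , _) = ∈-filter⁺ D? (∈-map⁺ suc (∈-upTo⁺ (ℕ.∣⇒≤ d∣n))) x

-- All divisors of the odd number m are odd, and they are precisely the odd divisors of 2^e m; z is
-- recovered from y as the cofactor in m.
τ≡σodd : ∀ e m → m % 2 ≡ 1 → τ (+ m) ≡ + σodd (2 ℕ.^ e ℕ.* m)
τ≡σodd e m@(suc m-1) m-odd = begin
  τ (+ m)
    ≡⟨ ∑-cong (enumT (+ m)) (λ _ (0<y , _) → sym (ℤ.0≤i⇒+∣i∣≡i (ℤ.<⇒≤ 0<y))) ⟩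
  ∑ (enumT (+ m)) (λ (y , _) → + ∣ y ∣)
    ≡⟨ ∑-≅ (enumT (+ m)) (enumOddDivisor n) T≅OddDivisor (λ d → + d) ⟩
  ∑ (enumOddDivisor n) (λ d → + d)
    ≡⟨ go (list (enumOddDivisor n)) ⟩
  + σodd n                                     ∎
  where
  open ≡-Reasoning
  n = 2 ℕ.^ e ℕ.* m
  instance
    n≢0 : ℕ.NonZero n
    n≢0 = ℕ.m*n≢0 (2 ℕ.^ e) m {{ℕ.m^n≢0 2 e}}
  go : ∀ ds → sumℤ (map +_ ds) ≡ + sum ds
  go []       = refl
  go (d ∷ ds) = cong (_+_ (+ d)) (go ds)
  pair : ℕ → ℤ × ℤ
  -- A placeholder: 0 is even, hence never an odd divisor.
  pair zero    = 0ℤ , 0ℤ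
  pair (suc d) = + suc d , + (m / suc d)
  to-ok : ∀ x → T (+ m) x → OddDivisor n ∣ proj₁ x ∣
  to-ok (+ suc a , + suc b) (_ , _ , eq) = ℕ.∣n⇒∣m*n (2 ℕ.^ e) a∣m , a-odd
    where
    a∣m : suc a ℕ.∣ m
    a∣m = ℕ.divides (suc b) (trans (sym (ℤ.+-injective eq)) (ℕ.*-comm (suc a) (suc b)))
    a-odd : suc a % 2 ≡ 1
    a-odd with oddℕ (suc a)
    ... | inj₁ o   = o
    ... | inj₂ 2∣a = contradiction (ℕ.∣-trans 2∣a a∣m) (%2≡1⇒2∤ m-odd)
  to-ok (+ zero , _) (+<+ () , _)
  to-ok (+ suc a , + zero) (_ , +<+ () , _)
  from-ok : ∀ d → OddDivisor n d → T (+ m) (pair d)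
  from-ok (suc d) (d∣n , d-odd) =
    +<+ (ℕ.s≤s ℕ.z≤n) , +<+ (m≥n⇒m/n>0 (ℕ.∣⇒≤ d∣m))
    , trans (sym (ℤ.pos-* (suc d) (m / suc d))) (cong +_ (m*[n/m]≡n d∣m))
    where
    d∣m : suc d ℕ.∣ m
    d∣m = odd∣2^e*m⇒∣m e m d-odd d∣n
  from-to : ∀ x → T (+ m) x → pair ∣ proj₁ x ∣ ≡ x
  from-to (+ suc a , + suc b) (_ , _ , eq) = cong (λ k → + suc a , + k)
    (trans (cong (_/ suc a) (trans (sym (ℤ.+-injective eq)) (ℕ.*-comm (suc a) (suc b))))
      (m*n/n≡m (suc b) (suc a)))
  from-to (+ zero , _) (+<+ () , _)
  from-to (+ suc a , + zero) (_ , +<+ () , _)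
  T≅OddDivisor : T (+ m) ≅ OddDivisor n
  T≅OddDivisor = record
    { to = λ (y , _) → ∣ y ∣ ; from = pair ; to-∈ = to-ok ; from-∈ = from-ok
    ; from∘to = from-to ; to∘from = λ { (suc _) _ → refl ; zero (_ , ()) } }

G≅𝒢 : ∀ n → G n ≅ (λ q → q ∈𝒢 × nrd q ≡ n)
G≅𝒢 n = record
  { to = x↔y ; from = x↔y ; to-∈ = mem ; from-∈ = mem′ 
  ; from∘to = λ _ _ → refl ; to∘from = λ _ _ → refl }
  where
  x↔y : Quat → Quat
  x↔y (quat a b c d) = quat a c b d
  nrd-x↔y : ∀ a b c d → a * a + c * c + b * b + d * d ≡ a * a + b * b + c * c + d * d
  nrd-x↔y = solve-∀
  lem₁ : ∀ c d → c ≡ (c + d) + d - d - d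
  lem₁ = solve-∀
  lem₂ : ∀ s d → s * + 2 + d - d - d ≡ + 2 * (s - d) + d
  lem₂ = solve-∀
  lem₃ : ∀ b d → + 2 * b + d + d ≡ (b + d) * + 2
  lem₃ = solve-∀
  mem : ∀ q → G n q → x↔y q ∈𝒢 × nrd (x↔y q) ≡ n
  mem (quat a b c d) ((eq , divides s cd) , divides t b-even) =
    -- Here c is the coefficient of 𝐢 and d that of 𝐤; from c + d = 2s the coefficient of 2𝐢 is (c -
    -- d)/2 = s - d.
    (a , s - d , t , d , cong₂ (λ u v → quat a u v d)
      (trans (lem₁ c d) (trans (cong (λ k → k + d - d - d) cd) (lem₂ s d)))
      (trans b-even (ℤ.*-comm t (+ 2))))
    , trans (nrd-x↔y a b c d) eq
  mem′ : ∀ q → q ∈𝒢 × nrd q ≡ n → G n (x↔y q)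
  mem′ _ ((a , b , c , d , refl) , eq) =
    (trans (nrd-x↔y a (+ 2 * b + d) (+ 2 * c) d) eq , divides (b + d) (lem₃ b d))
    , divides c (ℤ.*-comm (+ 2) c)

theorem3p33 : (n e m : ℕ) → m % 2 ≡ 1 → n ≡ 2 ℕ.^ e ℕ.* m →
    Σ (List Quat) λ L → Unique L
    × ((q : Quat) → (q ∈ L) ⇔ ((q ∈𝒢) × (nrd q ≡ + n)))
    × (length L ≡ 2 ℕ.* σodd n ℕ.* factor e)
theorem3p33 n e m m-odd refl =
  list E , unique E , (λ q → mk⇔ (sound E) (complete E)) , ℤ.+-injective (begin
  + length (list E)                        ≡⟨ card≡length E ⟨
  card E                                   ≡⟨ card-≅ (enumG (+ n)) E (G≅𝒢 (+ n)) ⟨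
  card (enumG (+ n))                       ≡⟨ cong (λ k → card (enumG k)) (+2^e*m e m) ⟩
  card (enumG (2^ e · + m))                ≡⟨ card-G (+ m) (%2≡1⇒odd m m-odd) e ⟩
  + 2 * τ (+ m) * + factor e               ≡⟨ cong (λ k → + 2 * k * + factor e) (τ≡σodd e m m-odd) ⟩
  + 2 * + σodd n * + factor e              ≡⟨ cong (_* + factor e) (ℤ.pos-* 2 (σodd n)) ⟨
  + (2 ℕ.* σodd n) * + factor e            ≡⟨ ℤ.pos-* (2 ℕ.* σodd n) (factor e) ⟨
  + (2 ℕ.* σodd n ℕ.* factor e)            ∎)
  where
  open ≡-Reasoning
  E : Enum (λ q → q ∈𝒢 × nrd q ≡ + n)
  E = image (G≅𝒢 (+ n)) (enumG (+ n))
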